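{- Let $r\ge 4$ and $q\ge 1$ be integers. Let $J$ be a graph with $n=|V(J)|$ and $m=\chi(J)>q$, and put $$M_q=\frac{(m-q)^2}{2q}.$$ Suppose there is $p\in(0,1]$ such that $$pM_q\ge 16(n\log q+\log 4)\qquad\text{and}\qquad \sum_{\ell=3}^{r-1}p^\ell C_\ell(J)\le \frac{pM_q}{16}.$$ Then $J$ contains a subgraph $H$ with $\operatorname{girth}(H)\ge r$ and $\chi(H)\ge q+1$.
   Context: All graphs are finite and simple; subgraphs need not be induced. $\chi$ is the chromatic number; the girth of a forest is $\infty$; $\log$ is natural. $C_\ell(J)$ is the number of cycles of length $\ell$ in $J$, counted as unoriented simple subgraphs. -}

module Defs where

open import Level using (0ℓ)
open import Data.Nat as ℕ using (ℕ; zero; suc; NonZero)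
import Data.Nat.Properties as ℕ
open import Data.Nat.DivMod using (_mod_)
import Data.Nat.Solver as ℕS
open import Data.Integer as ℤ using (+_; -[1+_])
import Data.Integer.Properties as ℤ
import Data.Integer.Solver as ℤS
open import Data.Rational as ℚ
  using (ℚ; mkℚ; 0ℚ; 1ℚ; _+_; _*_; _-_; -_; ∣_∣; _≤_; _<_; _/_; 1/_)
import Data.Rational.Properties as ℚ
open import Data.Rational.Unnormalised as ℚᵘ using (mkℚᵘ)
import Data.Rational.Unnormalised.Properties as ℚᵘ
open import Data.Rational.Solver using (module +-*-Solver)
open import Algebra.Properties.Group ℚ.+-0-group using (⁻¹-involutive)
open import Data.Fin as Fin using (Fin; toℕ)
open import Data.Fin.Properties as Fin using (all?; any?)
open import Data.Vec using (Vec; []; _∷_; lookup; tabulate)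
open import Data.Vec.Properties using (≡-dec)
open import Data.Bool using (Bool)
import Data.Bool.Properties as Bool
open import Data.List as List
  using (List; [_]; length; allFin; cartesianProductWith; filter; deduplicate; applyUpTo)
open import Data.Product using (Σ-syntax; ∃-syntax; _×_; _,_)
open import Data.Sum using (inj₁; inj₂)
open import Function.Definitions using (Injective)
open import Relation.Binary.Core using (Rel; _Preserves_⟶_)
open import Relation.Binary.Definitions using (Symmetric; Irreflexive; Decidable)
open import Relation.Binary.PropositionalEquality
  using (_≡_; _≢_; refl; sym; trans; cong; cong₂; subst; subst₂)
open import Relation.Nullary using (¬_; Dec)
open import Relation.Nullary.Decidable
  using (⌊_⌋; _×-dec_; _⊎-dec_; _→-dec_; toWitness)
open import Relation.Nullary.Construct.Add.Supremum using (_⁺; ⊤⁺) renaming ([_] to fin)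

------------------------------------------------------------------------

record Graph (n : ℕ) : Set₁ where
  infix 4 _~_ _~?_
  field
    _~_    : Rel (Fin n) 0ℓ
    _~?_   : Decidable _~_
    symm   : Symmetric _~_
    irrefl : Irreflexive _≡_ _~_

-- H ⊆ᴳ J: a copy of H inside J, not necessarily induced or spanning.
record _⊆ᴳ_ {k n : ℕ} (H : Graph k) (J : Graph n) : Set where
  private
    module H = Graph H
    module J = Graph J
  field
    embed     : Fin k → Fin n
    injective : Injective _≡_ _≡_ embed
    edges     : embed Preserves H._~_ ⟶ J._~_

Colourable : ∀ {n} → Graph n → ℕ → Set
Colourable {n} G k = Σ[ c ∈ (Fin n → Fin k) ] (∀ u v → u ~ v → c u ≢ c v)
  where open Graph G

IsChromaticNumber : ∀ {n} → Graph n → ℕ → Set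
IsChromaticNumber G m = Colourable G m × (∀ k → Colourable G k → m ℕ.≤ k)

next : ∀ {ℓ} → Fin ℓ → Fin ℓ
next {suc ℓ} i = suc (toℕ i) mod suc ℓ

-- v lists the vertices of a cycle of G in cyclic order, with some starting
-- point and orientation.
IsCycle : ∀ {n ℓ} → Graph n → Vec (Fin n) ℓ → Set
IsCycle {ℓ = ℓ} G v =
  3 ℕ.≤ ℓ ×
  (∀ i j → lookup v i ≡ lookup v j → i ≡ j) ×
  (∀ i → lookup v i ~ lookup v (next i))
  where open Graph G

isCycle? : ∀ {n ℓ} (G : Graph n) (v : Vec (Fin n) ℓ) → Dec (IsCycle G v)
isCycle? {ℓ = ℓ} G v =
  (3 ℕ.≤? ℓ) ×-dec
  all? (λ i → all? λ j → (lookup v i Fin.≟ lookup v j) →-dec (i Fin.≟ j)) ×-dec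
  all? (λ i → lookup v i ~? lookup v (next i))
  where open Graph G

HasCycle : ∀ {n} → Graph n → ℕ → Set
HasCycle {n} G ℓ = Σ[ v ∈ Vec (Fin n) ℓ ] IsCycle G v

-- The girth, valued in ℕ with a top element ⊤⁺ = ∞.
IsGirth : ∀ {n} → Graph n → ℕ ⁺ → Set
IsGirth G ⊤⁺      = ∀ ℓ → ¬ HasCycle G ℓ
IsGirth G (fin g) = HasCycle G g × (∀ ℓ → HasCycle G ℓ → g ℕ.≤ ℓ)

-- The edge set, as a symmetric Boolean matrix, of the closed walk v.  A cycle
-- has no isolated vertices, so as a subgraph it is determined by this matrix.
edgeSet : ∀ {n ℓ} → Vec (Fin n) ℓ → Vec (Vec Bool n) n
edgeSet v = tabulate λ a → tabulate λ b → ⌊ any? (λ i →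
  ((lookup v i Fin.≟ a) ×-dec (lookup v (next i) Fin.≟ b)) ⊎-dec
  ((lookup v i Fin.≟ b) ×-dec (lookup v (next i) Fin.≟ a))) ⌋

vertexTuples : ∀ n ℓ → List (Vec (Fin n) ℓ)
vertexTuples n zero    = [ [] ]
vertexTuples n (suc ℓ) = cartesianProductWith _∷_ (allFin n) (vertexTuples n ℓ)

-- Each cycle subgraph of length ℓ arises from 2ℓ vertex tuples; removing
-- duplicates counts it once.
cycleSubgraphs : ∀ {n} → ℕ → Graph n → List (Vec (Vec Bool n) n)
cycleSubgraphs {n} ℓ J =
  deduplicate (≡-dec (≡-dec Bool._≟_))
    (List.map edgeSet (filter (isCycle? J) (vertexTuples n ℓ)))

C : ∀ {n} → ℕ → Graph n → ℕ
C ℓ J = length (cycleSubgraphs ℓ J)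

------------------------------------------------------------------------

IsCauchy : (ℕ → ℚ) → Set
IsCauchy x = ∀ ε → 0ℚ < ε → ∃[ N ] ∀ m n → N ℕ.≤ m → N ℕ.≤ n → ∣ x m - x n ∣ < ε

record ℝ : Set where
  constructor mkℝ
  field
    seq    : ℕ → ℚ
    cauchy : IsCauchy seq
open ℝ public

infix 4 _≤ᵣ_ _<ᵣ_

_≤ᵣ_ : ℝ → ℝ → Set
x ≤ᵣ y = ∀ ε → 0ℚ < ε → ∃[ N ] ∀ n → N ℕ.≤ n → seq x n ≤ seq y n + ε

_<ᵣ_ : ℝ → ℝ → Set
x <ᵣ y = ∃[ ε ] 0ℚ < ε × (∃[ N ] ∀ n → N ℕ.≤ n → seq x n + ε ≤ seq y n)

fromℚ : ℚ → ℝ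
fromℚ a = mkℝ (λ _ → a) λ ε 0<ε →
  0 , λ _ _ _ _ → subst (_< ε) (sym (cong ∣_∣ (ℚ.+-inverseʳ a))) 0<ε

fromℕ : ℕ → ℝ
fromℕ n = fromℚ (+ n / 1)

private
  half : ∀ ε → ℚ.½ * ε + ℚ.½ * ε ≡ ε
  half ε = trans (sym (ℚ.*-distribʳ-+ ε ℚ.½ ℚ.½)) (ℚ.*-identityˡ ε)

  half-pos : ∀ ε → 0ℚ < ε → 0ℚ < ℚ.½ * ε
  half-pos ε 0<ε = subst (_< ℚ.½ * ε) (ℚ.*-zeroʳ ℚ.½) (ℚ.*-monoʳ-<-pos ℚ.½ 0<ε)

infixl 6 _+ᵣ_
infixl 7 _*ᵣ_
infixr 8 _^ᵣ_

_+ᵣ_ : ℝ → ℝ → ℝ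
x +ᵣ y = mkℝ (λ n → seq x n + seq y n) +-cauchy
  where
  regroup : ∀ a b c d → (a + b) - (c + d) ≡ (a - c) + (b - d)
  regroup = solve 4 (λ a b c d → (a :+ b) :- (c :+ d) := (a :- c) :+ (b :- d)) refl
    where open +-*-Solver

  +-cauchy : IsCauchy (λ n → seq x n + seq y n)
  +-cauchy ε 0<ε
    with N₁ , f ← cauchy x (ℚ.½ * ε) (half-pos ε 0<ε)
       | N₂ , g ← cauchy y (ℚ.½ * ε) (half-pos ε 0<ε)
    = N₁ ℕ.⊔ N₂ , λ m n N≤m N≤n → begin-strict
      ∣ (seq x m + seq y m) - (seq x n + seq y n) ∣
        ≡⟨ cong ∣_∣ (regroup (seq x m) (seq y m) (seq x n) (seq y n)) ⟩
      ∣ (seq x m - seq x n) + (seq y m - seq y n) ∣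
        ≤⟨ ℚ.∣p+q∣≤∣p∣+∣q∣ (seq x m - seq x n) (seq y m - seq y n) ⟩
      ∣ seq x m - seq x n ∣ + ∣ seq y m - seq y n ∣
        <⟨ ℚ.+-mono-<
             (f m n (ℕ.m⊔n≤o⇒m≤o N₁ N₂ N≤m) (ℕ.m⊔n≤o⇒m≤o N₁ N₂ N≤n))
             (g m n (ℕ.m⊔n≤o⇒n≤o N₁ N₂ N≤m) (ℕ.m⊔n≤o⇒n≤o N₁ N₂ N≤n)) ⟩
      ℚ.½ * ε + ℚ.½ * ε
        ≡⟨ half ε ⟩
      ε ∎
    where open ℚ.≤-Reasoning

private
  p-q+q≡p : ∀ p q → (p - q) + q ≡ p
  p-q+q≡p = solve 2 (λ p q → (p :- q) :+ q := p) refl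
    where open +-*-Solver

  eventually-bounded : ∀ x → ∃[ N ] ∀ n → N ℕ.≤ n → ∣ seq x n ∣ ≤ 1ℚ + ∣ seq x N ∣
  eventually-bounded x with N , f ← cauchy x 1ℚ (toWitness {a? = 0ℚ ℚ.<? 1ℚ} _) =
    N , λ n N≤n → begin
      ∣ seq x n ∣
        ≡⟨ cong ∣_∣ (sym (p-q+q≡p (seq x n) (seq x N))) ⟩
      ∣ (seq x n - seq x N) + seq x N ∣
        ≤⟨ ℚ.∣p+q∣≤∣p∣+∣q∣ (seq x n - seq x N) (seq x N) ⟩
      ∣ seq x n - seq x N ∣ + ∣ seq x N ∣
        ≤⟨ ℚ.+-monoˡ-≤ ∣ seq x N ∣ (ℚ.<⇒≤ (f n N N≤n ℕ.≤-refl)) ⟩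
      1ℚ + ∣ seq x N ∣ ∎
    where open ℚ.≤-Reasoning

private
  ab-cd : ∀ a b c d → a * b - c * d ≡ a * (b - d) + (a - c) * d
  ab-cd a b c d = sym (trans
    (cong₂ _+_
      (trans (ℚ.*-distribˡ-+ a b (- d)) (cong (λ z → a * b + z) (sym (ℚ.neg-distribʳ-* a d))))
      (trans (ℚ.*-distribʳ-+ d a (- c)) (cong (λ z → a * d + z) (sym (ℚ.neg-distribˡ-* c d)))))
    (trans (sym (ℚ.+-assoc (a * b - a * d) (a * d) (- (c * d))))
           (cong (λ z → z - c * d) (p-q+q≡p (a * b) (a * d)))))

  ⊔₄≤ : ∀ a b c d {o} → (a ℕ.⊔ b) ℕ.⊔ (c ℕ.⊔ d) ℕ.≤ o →
         a ℕ.≤ o × b ℕ.≤ o × c ℕ.≤ o × d ℕ.≤ o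
  ⊔₄≤ a b c d p =
    ℕ.m⊔n≤o⇒m≤o a b p₁ , ℕ.m⊔n≤o⇒n≤o a b p₁ , ℕ.m⊔n≤o⇒m≤o c d p₂ , ℕ.m⊔n≤o⇒n≤o c d p₂
    where
    p₁ = ℕ.m⊔n≤o⇒m≤o (a ℕ.⊔ b) (c ℕ.⊔ d) p
    p₂ = ℕ.m⊔n≤o⇒n≤o (a ℕ.⊔ b) (c ℕ.⊔ d) p

  1+∣p∣-pos : ∀ p → ℚ.Positive (1ℚ + ∣ p ∣)
  1+∣p∣-pos p = ℚ.pos+nonNeg⇒pos 1ℚ ∣ p ∣ {{ℚ.∣-∣-nonNeg p}}

  share : ∀ B → ℚ.Positive B → ∀ ε → 0ℚ < ε → ∃[ δ ] (0ℚ < δ × B * δ ≡ ℚ.½ * ε)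
  share B B-pos ε 0<ε = inv * (ℚ.½ * ε) ,
    subst (_< inv * (ℚ.½ * ε)) (ℚ.*-zeroʳ inv)
      (ℚ.*-monoʳ-<-pos inv {{ℚ.1/pos⇒pos B {{B-pos}}}} (half-pos ε 0<ε)) ,
    trans (sym (ℚ.*-assoc B inv (ℚ.½ * ε)))
      (trans (cong (λ z → z * (ℚ.½ * ε)) (ℚ.*-inverseʳ B {{ℚ.pos⇒nonZero B {{B-pos}}}}))
             (ℚ.*-identityˡ (ℚ.½ * ε)))
    where
    inv : ℚ
    inv = (1/ B) {{ℚ.pos⇒nonZero B {{B-pos}}}}

  product-bound : ∀ a b c d B₁ B₂ δ₁ δ₂ ε → ℚ.Positive B₁ → ℚ.Positive B₂ →
    ∣ a ∣ ≤ B₁ → ∣ d ∣ ≤ B₂ → ∣ b - d ∣ < δ₁ → ∣ a - c ∣ < δ₂ →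
    B₁ * δ₁ ≡ ℚ.½ * ε → B₂ * δ₂ ≡ ℚ.½ * ε →
    ∣ a * b - c * d ∣ < ε
  product-bound a b c d B₁ B₂ δ₁ δ₂ ε B₁-pos B₂-pos a≤ d≤ bd ac e₁ e₂ = begin-strict
    ∣ a * b - c * d ∣
      ≡⟨ cong ∣_∣ (ab-cd a b c d) ⟩
    ∣ a * (b - d) + (a - c) * d ∣
      ≤⟨ ℚ.∣p+q∣≤∣p∣+∣q∣ (a * (b - d)) ((a - c) * d) ⟩
    ∣ a * (b - d) ∣ + ∣ (a - c) * d ∣
      ≡⟨ cong₂ _+_ (ℚ.∣p*q∣≡∣p∣*∣q∣ a (b - d))
                   (trans (ℚ.∣p*q∣≡∣p∣*∣q∣ (a - c) d) (ℚ.*-comm ∣ a - c ∣ ∣ d ∣)) ⟩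
    ∣ a ∣ * ∣ b - d ∣ + ∣ d ∣ * ∣ a - c ∣
      ≤⟨ ℚ.+-mono-≤
           (ℚ.*-monoʳ-≤-nonNeg ∣ b - d ∣ {{ℚ.∣-∣-nonNeg (b - d)}} a≤)
           (ℚ.*-monoʳ-≤-nonNeg ∣ a - c ∣ {{ℚ.∣-∣-nonNeg (a - c)}} d≤) ⟩
    B₁ * ∣ b - d ∣ + B₂ * ∣ a - c ∣
      <⟨ ℚ.+-mono-< (ℚ.*-monoʳ-<-pos B₁ {{B₁-pos}} bd) (ℚ.*-monoʳ-<-pos B₂ {{B₂-pos}} ac) ⟩
    B₁ * δ₁ + B₂ * δ₂
      ≡⟨ cong₂ _+_ e₁ e₂ ⟩
    ℚ.½ * ε + ℚ.½ * ε
      ≡⟨ half ε ⟩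
    ε ∎
    where open ℚ.≤-Reasoning

_*ᵣ_ : ℝ → ℝ → ℝ
x *ᵣ y = mkℝ (λ n → seq x n * seq y n) *-cauchy
  where
  *-cauchy : IsCauchy (λ n → seq x n * seq y n)
  *-cauchy ε 0<ε =
    let N₁ , f = eventually-bounded x
        N₂ , g = eventually-bounded y
        B₁ = 1ℚ + ∣ seq x N₁ ∣
        B₂ = 1ℚ + ∣ seq y N₂ ∣
        B₁-pos = 1+∣p∣-pos (seq x N₁)
        B₂-pos = 1+∣p∣-pos (seq y N₂)
        δ₁ , 0<δ₁ , e₁ = share B₁ B₁-pos ε 0<ε
        δ₂ , 0<δ₂ , e₂ = share B₂ B₂-pos ε 0<ε
        N₃ , h = cauchy y δ₁ 0<δ₁
        N₄ , k = cauchy x δ₂ 0<δ₂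
    in (N₁ ℕ.⊔ N₂) ℕ.⊔ (N₃ ℕ.⊔ N₄) , λ m n N≤m N≤n →
      let m₁ , m₂ , m₃ , m₄ = ⊔₄≤ N₁ N₂ N₃ N₄ N≤m
          n₁ , n₂ , n₃ , n₄ = ⊔₄≤ N₁ N₂ N₃ N₄ N≤n
      in product-bound (seq x m) (seq y m) (seq x n) (seq y n) B₁ B₂ δ₁ δ₂ ε B₁-pos B₂-pos
           (f m m₁) (g n n₂) (h m n m₃ n₃) (k m n m₄ n₄) e₁ e₂

_^ᵣ_ : ℝ → ℕ → ℝ
x ^ᵣ zero  = fromℚ 1ℚ
x ^ᵣ suc k = x *ᵣ x ^ᵣ k

sumᵣ : List ℝ → ℝ
sumᵣ = List.foldr _+ᵣ_ (fromℚ 0ℚ)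

------------------------------------------------------------------------

-- Σ_{j < k} 1 / (a + j + 1)
reciprocals : ℕ → ℕ → ℚ
reciprocals a zero    = 0ℚ
reciprocals a (suc k) = reciprocals a k + + 1 / suc (a ℕ.+ k)

-- log q = ∫₁^q dt/t.  With mesh 1/N the right Riemann sum is
-- Σ_{j < (q-1)N} (1/N) · 1 / (1 + (j+1)/N) = Σ_{j < (q-1)N} 1 / (N + j + 1).
riemannSum : ℕ → ℕ → ℚ
riemannSum q N = reciprocals N ((q ℕ.∸ 1) ℕ.* N)

private
  1/suc : ℕ → ℚ
  1/suc k = + 1 / suc k

  toℚᵘ-1/suc : ∀ k → ℚ.toℚᵘ (1/suc k) ℚᵘ.≃ mkℚᵘ (+ 1) k
  toℚᵘ-1/suc k = ℚ.toℚᵘ-fromℚᵘ (mkℚᵘ (+ 1) k)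

  1/suc-anti : ∀ {j k} → j ℕ.≤ k → 1/suc k ≤ 1/suc j
  1/suc-anti {j} {k} j≤k = ℚ.toℚᵘ-cancel-≤
    (ℚᵘ.≤-respˡ-≃ (ℚᵘ.≃-sym (toℚᵘ-1/suc k)) (ℚᵘ.≤-respʳ-≃ (ℚᵘ.≃-sym (toℚᵘ-1/suc j))
      (ℚᵘ.*≤* (ℤ.+≤+ (ℕ.+-mono-≤ (ℕ.s≤s j≤k) ℕ.z≤n)))))

  1/suc-small : ∀ ε → 0ℚ < ε → ∃[ d ] 1/suc d < ε
  1/suc-small ε@(mkℚ (+ suc n) d _) 0<ε = suc d , ℚ.toℚᵘ-cancel-<
    (ℚᵘ.<-respˡ-≃ (ℚᵘ.≃-sym (toℚᵘ-1/suc (suc d)))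
      (ℚᵘ.*<* (ℤ.+<+ (ℕ.≤-trans (ℕ.≤-reflexive (cong suc (ℕ.+-identityʳ (suc d))))
                                (ℕ.m≤m+n (suc (suc d)) (n ℕ.* suc (suc d)))))))
  1/suc-small (mkℚ (+ zero) d _) (ℚ.*<* (ℤ.+<+ ()))
  1/suc-small (mkℚ -[1+ n ] d _) (ℚ.*<* ())

  times : ℕ → ℚ → ℚ
  times zero    x = 0ℚ
  times (suc k) x = times k x + x

  times-1/suc : ∀ k d → ℚ.toℚᵘ (times k (1/suc d)) ℚᵘ.≃ mkℚᵘ (+ k) d
  times-1/suc zero d = ℚᵘ.*≡* refl
  times-1/suc (suc k) d =
    ℚᵘ.≃-trans (ℚ.toℚᵘ-homo-+ (times k (1/suc d)) (1/suc d))
    (ℚᵘ.≃-trans (ℚᵘ.+-cong (times-1/suc k d) (toℚᵘ-1/suc d))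
    (ℚᵘ.*≡* (lemma (+ k) (+ suc d))))
    where
    open ℤS.+-*-Solver
    lemma : ∀ k D → (k ℤ.* D ℤ.+ + 1 ℤ.* D) ℤ.* D ≡ (+ 1 ℤ.+ k) ℤ.* (D ℤ.* D)
    lemma = solve 2 (λ k D → (k :* D :+ con (+ 1) :* D) :* D := (con (+ 1) :+ k) :* (D :* D)) refl

  -- suc q copies of 1 / (suc q · suc a)
  times-cancel : ∀ q a → times (suc q) (1/suc (a ℕ.+ q ℕ.* suc a)) ≡ 1/suc a
  times-cancel q a = ℚ.toℚᵘ-injective
    (ℚᵘ.≃-trans (times-1/suc (suc q) (a ℕ.+ q ℕ.* suc a))
    (ℚᵘ.≃-trans (ℚᵘ.*≡* (cong +_ (sym (ℕ.*-identityˡ _))))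
    (ℚᵘ.≃-sym (toℚᵘ-1/suc a))))

  reciprocals-≤ : ∀ a k → reciprocals (suc a) k ≤ times k (1/suc a)
  reciprocals-≤ a zero    = ℚ.≤-refl
  reciprocals-≤ a (suc k) = ℚ.+-mono-≤ (reciprocals-≤ a k)
    (1/suc-anti (ℕ.m≤n⇒m≤1+n (ℕ.m≤m+n a k)))

  reciprocals-≥ : ∀ a k b → a ℕ.+ k ℕ.≤ suc b → times k (1/suc b) ≤ reciprocals a k
  reciprocals-≥ a zero    b _ = ℚ.≤-refl
  reciprocals-≥ a (suc k) b p = ℚ.+-mono-≤
    (reciprocals-≥ a k b (ℕ.≤-trans (ℕ.+-monoʳ-≤ a (ℕ.n≤1+n k)) p))
    (1/suc-anti (ℕ.≤-pred (ℕ.≤-trans (ℕ.≤-reflexive (sym (ℕ.+-suc a k))) p)))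

  reciprocals-+ : ∀ a k l → reciprocals a (k ℕ.+ l) ≡ reciprocals a k + reciprocals (a ℕ.+ k) l
  reciprocals-+ a k zero = trans (cong (reciprocals a) (ℕ.+-identityʳ k)) (sym (ℚ.+-identityʳ _))
  reciprocals-+ a k (suc l) = trans (cong (reciprocals a) (ℕ.+-suc k l))
    (trans (cong₂ _+_ (reciprocals-+ a k l) (cong 1/suc (sym (ℕ.+-assoc a k l))))
           (ℚ.+-assoc (reciprocals a k) _ _))

  +-cancelˡ-≤ : ∀ r {x y} → r + x ≤ r + y → x ≤ y
  +-cancelˡ-≤ r {x} {y} p = subst₂ _≤_ (strip x) (strip y) (ℚ.+-monoʳ-≤ (- r) p)
    where
    strip : ∀ z → - r + (r + z) ≡ z
    strip z = trans (sym (ℚ.+-assoc (- r) r z))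
      (trans (cong (λ w → w + z) (ℚ.+-inverseˡ r)) (ℚ.+-identityˡ z))

  x<y+ε⇒x-y<ε : ∀ {x y ε} → x < y + ε → x - y < ε
  x<y+ε⇒x-y<ε {x} {y} {ε} p = subst (x - y <_)
    (trans (cong (λ w → w - y) (ℚ.+-comm y ε))
    (trans (ℚ.+-assoc ε y (- y)) (trans (cong (λ w → ε + w) (ℚ.+-inverseʳ y)) (ℚ.+-identityʳ ε))))
    (ℚ.+-monoˡ-< (- y) p)

  ∣x-y∣<ε : ∀ {x y ε} → x < y + ε → y < x + ε → ∣ x - y ∣ < ε
  ∣x-y∣<ε {x} {y} {ε} p q with ℚ.∣p∣≡p∨∣p∣≡-p (x - y)
  ... | inj₁ eq = subst (_< ε) (sym eq) (x<y+ε⇒x-y<ε p)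
  ... | inj₂ eq = subst (_< ε) (sym (trans eq flip)) (x<y+ε⇒x-y<ε q)
    where
    flip : - (x - y) ≡ y - x
    flip = trans (ℚ.neg-distrib-+ x (- y)) (trans (ℚ.+-comm (- x) (- - y))
      (cong (λ w → w - x) (⁻¹-involutive y)))

  module LogCauchy (c : ℕ) where
    f : ℕ → ℚ
    f a = riemannSum (suc c) (suc a)

    block : ℕ → ℚ
    block a = reciprocals (suc a ℕ.+ c ℕ.* suc a) (suc c)

    step : ∀ a → 1/suc (suc a) + f (suc a) ≡ f a + block a
    step a =
      trans (cong (λ z → z + f (suc a)) head)
      (trans (cong (λ z → reciprocals (suc a) 1 + reciprocals z (c ℕ.* suc (suc a)))
                   (sym (ℕ.+-comm (suc a) 1)))
      (trans (sym (reciprocals-+ (suc a) 1 (c ℕ.* suc (suc a))))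
      (trans (cong (reciprocals (suc a)) (lemma c (suc a)))
             (reciprocals-+ (suc a) (c ℕ.* suc a) (suc c)))))
      where
      head : 1/suc (suc a) ≡ reciprocals (suc a) 1
      head = trans (cong 1/suc (sym (ℕ.+-identityʳ (suc a)))) (sym (ℚ.+-identityˡ _))
      lemma : ∀ c A → 1 ℕ.+ c ℕ.* suc A ≡ c ℕ.* A ℕ.+ suc c
      lemma = solve 2 (λ c A → con 1 :+ c :* (con 1 :+ A) := c :* A :+ (con 1 :+ c)) refl
        where open ℕS.+-*-Solver

    block-≤ : ∀ a → block a ≤ 1/suc a
    block-≤ a = subst (block a ≤_) (times-cancel c a) (reciprocals-≤ (a ℕ.+ c ℕ.* suc a) (suc c))

    block-≥ : ∀ a → 1/suc (suc a) ≤ block a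
    block-≥ a = subst (_≤ block a) (times-cancel c (suc a))
      (reciprocals-≥ (suc a ℕ.+ c ℕ.* suc a) (suc c) (suc a ℕ.+ c ℕ.* suc (suc a))
        (ℕ.≤-reflexive (lemma c (suc a))))
      where
      lemma : ∀ c A → A ℕ.+ c ℕ.* A ℕ.+ suc c ≡ suc (A ℕ.+ c ℕ.* suc A)
      lemma = solve 2 (λ c A → A :+ c :* A :+ (con 1 :+ c)
                             := con 1 :+ (A :+ c :* (con 1 :+ A))) refl
        where open ℕS.+-*-Solver

    f-suc : ∀ a → f a ≤ f (suc a)
    f-suc a = +-cancelˡ-≤ (1/suc (suc a)) (subst₂ _≤_ (ℚ.+-comm (f a) _) (sym (step a))
      (ℚ.+-monoʳ-≤ (f a) (block-≥ a)))

    g : ℕ → ℚ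
    g a = f a + 1/suc a

    g-suc : ∀ a → g (suc a) ≤ g a
    g-suc a = subst (_≤ g a) (trans (sym (step a)) (ℚ.+-comm _ (f (suc a))))
      (ℚ.+-monoʳ-≤ (f a) (block-≤ a))

    f-mono : ∀ {a b} → a ℕ.≤′ b → f a ≤ f b
    f-mono (ℕ.≤′-reflexive refl) = ℚ.≤-refl
    f-mono (ℕ.≤′-step p)         = ℚ.≤-trans (f-mono p) (f-suc _)

    g-anti : ∀ {a b} → a ℕ.≤′ b → g b ≤ g a
    g-anti (ℕ.≤′-reflexive refl) = ℚ.≤-refl
    g-anti (ℕ.≤′-step p)         = ℚ.≤-trans (g-suc _) (g-anti p)

    f≤g : ∀ a → f a ≤ g a
    f≤g a = subst (_≤ g a) (ℚ.+-identityʳ (f a)) (ℚ.+-monoʳ-≤ (f a) 0≤)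
      where
      0≤ : 0ℚ ≤ 1/suc a
      0≤ = ℚ.nonNegative⁻¹ (1/suc a) {{ℚ.normalize-nonNeg 1 (suc a)}}

    f-cauchy : IsCauchy f
    f-cauchy ε 0<ε with d , small ← 1/suc-small ε 0<ε =
      d , λ m n d≤m d≤n → ∣x-y∣<ε (close d≤m d≤n) (close d≤n d≤m)
      where
      close : ∀ {m n} → d ℕ.≤ m → d ℕ.≤ n → f m < f n + ε
      close {m} {n} d≤m d≤n = begin-strict
        f m            ≤⟨ f≤g m ⟩
        g m            ≤⟨ g-anti (ℕ.≤⇒≤′ d≤m) ⟩
        f d + 1/suc d  <⟨ ℚ.+-mono-≤-< (f-mono (ℕ.≤⇒≤′ d≤n)) small ⟩
        f n + ε        ∎
        where open ℚ.≤-Reasoning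

  riemannSum-cauchy : ∀ q → IsCauchy (λ N → riemannSum q (suc N))
  riemannSum-cauchy zero    = cauchy (fromℚ 0ℚ)
  riemannSum-cauchy (suc c) = LogCauchy.f-cauchy c

log : (q : ℕ) .{{_ : NonZero q}} → ℝ
log q = mkℝ (λ N → riemannSum q (suc N)) (riemannSum-cauchy q)

------------------------------------------------------------------------

M : (m q : ℕ) .{{_ : NonZero q}} → ℚ
M m q = ((+ m ℤ.- + q) ℤ.^ 2 / (2 ℕ.* q)) {{ℕ.m*n≢0 2 q}}

-- Σ_{ℓ = 3}^{r - 1} p^ℓ C_ℓ(J)
weightedShortCycles : ∀ {n} → ℝ → ℕ → Graph n → ℝ
weightedShortCycles p r J =
  sumᵣ (applyUpTo (λ i → p ^ᵣ (3 ℕ.+ i) *ᵣ fromℕ (C (3 ℕ.+ i) J)) (r ℕ.∸ 3))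

{-# OPTIONS --safe #-}

-- Keep each edge of J independently with probability p.  A q-colouring of V(J) has at
-- least M = (m - q)² / 2q monochromatic edges in J: colouring each class greedily, the
-- y-th new colour of a class is paid for by y of its edges, and the classes together use
-- at least m colours.  Instead of a Chernoff bound, one outcome is found for which
--   Σ_c 2^(K - #kept monochromatic edges of c) + #kept short cycles / K < 1,
-- where K ≈ pM / 8: it keeps more than K monochromatic edges of every colouring and fewer
-- than K short cycles, so deleting an edge of each kept short cycle leaves every
-- q-colouring improper.  The left side has expectation at most 1/4 + 5/8, because
-- (1 - p/2)^M ≤ 2^(-S) for integers S ≤ pM / 2 and because the hypothesis on log q gives
-- pM / 4 ≥ nL + 4 up to a small error, where L = ⌈log₂ q⌉; there log q ≥ L / 4 is read off
-- its Riemann sums.  The real p is replaced by a rational approximation a / (a + a′) and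
-- all denominators are cleared.
module Submission where

open import Defs
open import Data.Empty using (⊥-elim)
open import Data.List
  using (List; []; _∷_; map; length; concat; applyUpTo; allFin; cartesianProductWith)
open import Data.Nat.ListAction using (sum)
open import Data.Product using (∃-syntax; Σ-syntax; _×_; _,_; proj₁; proj₂; uncurry)
open import Data.Sum using (_⊎_; inj₁; inj₂; [_,_]′)
open import Function using (_∘_; id)
open import Relation.Binary.PropositionalEquality
  using (_≡_; _≢_; refl; sym; trans; cong; cong₂; subst; subst₂; ≢-sym; module ≡-Reasoning)
open import Relation.Nullary using (Dec; yes; no; ¬_)

module _ where
  open import Data.Bool using (Bool; true; false)
  import Data.Bool.Properties as Bool
  open import Data.Fin using (Fin; zero; suc; toℕ; fromℕ<; inject≤; splitAt; _↑ˡ_; _↑ʳ_)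
  import Data.Fin as Fin
  import Data.Fin.Properties as Finₚ
  open Finₚ using (any?; all?; toℕ-injective; toℕ-fromℕ<; toℕ<n; toℕ-↑ˡ; ↑ʳ-injective; splitAt-↑ˡ;
    splitAt-↑ʳ; splitAt⁻¹-↑ˡ; splitAt⁻¹-↑ʳ; ¬∀⟶∃¬)
  open import Data.Fin.Subset
    using (Subset; inside; outside; ∣_∣; _∩_; _⊆_; _∈_; _∉_; Nonempty; ⊥; _─_; ⁅_⁆)
    renaming (_-_ to _∖_)
  open import Data.Fin.Subset.Properties
    using (_∈?_; _⊆?_; nonempty?; drop-∷-⊆; Empty-unique; ∣⊥∣≡0; p─⊥≡p; p─q⊆p; x∈p∩q⁻;
      x∈p∧x≢y⇒x∈p-y; x∈p⇒∣p-x∣<∣p∣)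
  open import Data.List.Membership.Propositional using (find; lose) renaming (_∈_ to _∈ₗ_)
  open import Data.List.Membership.Propositional.Properties
    using (∈-map⁺; ∈-map⁻; ∈-concat⁺′; ∈-concat⁻′; ∈-cartesianProductWith⁺; ∈-applyUpTo⁺;
      ∈-applyUpTo⁻; ∈-allFin; ∈-filter⁺; ∈-filter⁻; ∈-deduplicate⁺; ∈-deduplicate⁻)
  open import Data.List.Properties using (map-cong; map-++; length-++; length-map; length-tabulate)
  open import Data.List.Relation.Unary.Any using (here; there) renaming (any? to anyₗ?)
  open import Data.Nat
  open import Data.Nat.DivMod using (_/_; _%_; m/n*n≤m; m≡m%n+[m/n]*n; m%n<n; m<n⇒m%n≡m; n%n≡0)
  open import Data.Nat.ListAction.Properties using (sum-++)
  open import Data.Nat.Properties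
  open import Algebra.Properties.Monoid.Sum +-0-monoid using () renaming (sum to ∑)
  open import Data.Nat.Tactic.RingSolver using (solve-∀)
  open import Data.Product using () renaming (map to map×; swap to swap×)
  open import Data.Product.Properties using () renaming (≡-dec to ×-≡-dec)
  open import Data.Sum using () renaming (swap to swap⊎)
  open import Data.Vec using (Vec; []; _∷_; here; there; tabulate; lookup)
  open import Data.Vec.Functional using (Vector; updateAt; tail)
  open import Data.Vec.Functional.Properties using (updateAt-updates)
  open import Data.Vec.Properties using (lookup∘tabulate; []=⇒lookup; lookup⇒[]=; tabulate-cong)
    renaming (≡-dec to Vec-≡-dec)
  open import Function.Definitions using (Injective)
  open import Relation.Binary.Construct.Add.Supremum.NonStrict _≤_ using (_≤⁺_; [_]; _≤⊤⁺)
  open import Relation.Nullary.Construct.Add.Supremum using (⊤⁺) renaming ([_] to fin)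
  open import Relation.Nullary.Decidable
    using (⌊_⌋; _×-dec_; _⊎-dec_; _→-dec_; ¬?; map′; dec-true; isYes≗does)

  -- Exponential decay in natural numbers

  ^-distribʳ-* : ∀ k x y → (x * y) ^ k ≡ x ^ k * y ^ k
  ^-distribʳ-* zero    x y = refl
  ^-distribʳ-* (suc k) x y = trans (cong ((x * y) *_) (^-distribʳ-* k x y)) (lemma x y (x ^ k) (y ^ k))
    where
    lemma : ∀ x y u v → x * y * (u * v) ≡ x * u * (y * v)
    lemma = solve-∀

  ^-cancelʳ-≤ : ∀ k .{{_ : NonZero k}} {x y} → x ^ k ≤ y ^ k → x ≤ y
  ^-cancelʳ-≤ k x^k≤y^k = ≮⇒≥ λ y<x → <⇒≱ (^-monoˡ-< k y<x) x^k≤y^k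

  -- Bernoulli's inequality 1 + k/x ≤ (1 + 1/x)^k for x > 0, multiplied by x^(k+1) so that it stays
  -- in ℕ.
  bernoulli : ∀ x k → (x + k) * x ^ k ≤ x * suc x ^ k
  bernoulli x zero    = ≤-reflexive (cong (_* 1) (+-identityʳ x))
  bernoulli x (suc k) = begin
    (x + suc k) * (x * x ^ k)                ≤⟨ m≤m+n _ (k * x ^ k) ⟩
    (x + suc k) * (x * x ^ k) + k * x ^ k    ≡⟨ expand x k (x ^ k) ⟩
    suc x * ((x + k) * x ^ k)                ≤⟨ *-monoʳ-≤ (suc x) (bernoulli x k) ⟩
    suc x * (x * suc x ^ k)                  ≡⟨ swap (suc x) x (suc x ^ k) ⟩
    x * (suc x * suc x ^ k)                  ∎
    where
    open ≤-Reasoning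
    expand : ∀ x k y → (x + suc k) * (x * y) + k * y ≡ suc x * ((x + k) * y)
    expand = solve-∀
    swap : ∀ x y z → x * (y * z) ≡ y * (x * z)
    swap = solve-∀

  -- By Bernoulli, (1 + 1/x)^k ≥ 1 + k/x ≥ 2 once k exceeds x; the base 0 is treated apart because
  -- the proof cancels x.
  double-^ : ∀ {x k} → x < k → x ^ k * 2 ≤ suc x ^ k
  double-^ {zero}    {suc k} _   = z≤n
  double-^ {x@(suc _)} {k}   x<k = *-cancelˡ-≤ x (begin
    x * (x ^ k * 2)      ≡⟨ regroup x (x ^ k) ⟩
    (x + x) * x ^ k      ≤⟨ *-monoˡ-≤ (x ^ k) (+-monoʳ-≤ x (<⇒≤ x<k)) ⟩
    (x + k) * x ^ k      ≤⟨ bernoulli x k ⟩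
    x * suc x ^ k        ∎)
    where
    open ≤-Reasoning
    regroup : ∀ x y → x * (y * 2) ≡ (x + x) * y
    regroup = solve-∀

  -- The base climbs from x to x + a in unit steps. It stays below k before each step, so each step
  -- at least doubles the k-th power.
  ^-*-2^-≤ : ∀ x a {k} → x + a ≤ k → x ^ k * 2 ^ a ≤ (x + a) ^ k
  ^-*-2^-≤ x zero    {k} _     = ≤-reflexive (trans (*-identityʳ _) (cong (_^ k) (sym (+-identityʳ x))))
  ^-*-2^-≤ x (suc a) {k} x+a≤k = begin
    x ^ k * (2 * 2 ^ a)     ≡⟨ *-assoc (x ^ k) 2 (2 ^ a) ⟨
    x ^ k * 2 * 2 ^ a       ≤⟨ *-monoˡ-≤ (2 ^ a) (double-^ (≤-trans (s≤s (m≤m+n x a)) 1+x+a≤k)) ⟩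
    suc x ^ k * 2 ^ a       ≤⟨ ^-*-2^-≤ (suc x) a 1+x+a≤k ⟩
    (suc x + a) ^ k         ≡⟨ cong (_^ k) (+-suc x a) ⟨
    (x + suc a) ^ k         ∎
    where
    open ≤-Reasoning
    1+x+a≤k : suc x + a ≤ k
    1+x+a≤k = subst (_≤ k) (+-suc x a) x+a≤k

  -- (1 - a/b)^k ≤ 2^(-s) whenever s ≤ (a/b)k, by comparing b-th powers.
  decay : ∀ x a k s {b} .{{_ : NonZero b}} → x + a ≡ b → b * s ≤ a * k → x ^ k * 2 ^ s ≤ b ^ k
  decay x a k s {b} x+a≡b bs≤ak = ^-cancelʳ-≤ b (begin
    (x ^ k * 2 ^ s) ^ b              ≡⟨ ^-distribʳ-* b (x ^ k) (2 ^ s) ⟩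
    (x ^ k) ^ b * (2 ^ s) ^ b
      ≡⟨ cong₂ _*_ (^-comm x k b) (trans (^-*-assoc 2 s b) (cong (2 ^_) (*-comm s b))) ⟩
    (x ^ b) ^ k * 2 ^ (b * s)    ≤⟨ *-monoʳ-≤ ((x ^ b) ^ k) (^-monoʳ-≤ 2 bs≤ak) ⟩
    (x ^ b) ^ k * 2 ^ (a * k)        ≡⟨ cong ((x ^ b) ^ k *_) (^-*-assoc 2 a k) ⟨
    (x ^ b) ^ k * (2 ^ a) ^ k        ≡⟨ ^-distribʳ-* k (x ^ b) (2 ^ a) ⟨
    (x ^ b * 2 ^ a) ^ k              ≤⟨ ^-monoˡ-≤ k (^-*-2^-≤ x a (≤-reflexive x+a≡b)) ⟩
    ((x + a) ^ b) ^ k                ≡⟨ cong (λ y → (y ^ b) ^ k) x+a≡b ⟩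
    (b ^ b) ^ k                  ≡⟨ ^-comm b b k ⟩
    (b ^ k) ^ b                  ∎)
    where
    open ≤-Reasoning
    ^-comm : ∀ x k l → (x ^ k) ^ l ≡ (x ^ l) ^ k
    ^-comm x k l = trans (^-*-assoc x k l) (trans (cong (x ^_) (*-comm k l)) (sym (^-*-assoc x l k)))

  -- Random subsets: weights, expectations, first moment

  module _ {a} {A : Set a} where

    sum-map-∈ : ∀ (f : A → ℕ) {x xs} → x ∈ₗ xs → f x ≤ sum (map f xs)
    sum-map-∈ f {xs = y ∷ ys} (here refl)  = m≤m+n (f y) _
    sum-map-∈ f {xs = y ∷ ys} (there x∈ys) = m≤n⇒m≤o+n (f y) (sum-map-∈ f x∈ys)

    sum-map-≤ : ∀ (f : A → ℕ) u v xs → (∀ {x} → x ∈ₗ xs → f x * u ≤ v) →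
                sum (map f xs) * u ≤ length xs * v
    sum-map-≤ f u v []       _     = z≤n
    sum-map-≤ f u v (x ∷ xs) bound = begin
      (f x + sum (map f xs)) * u        ≡⟨ *-distribʳ-+ u (f x) _ ⟩
      f x * u + sum (map f xs) * u
        ≤⟨ +-mono-≤ (bound (here refl)) (sum-map-≤ f u v xs (bound ∘ there)) ⟩
      v + length xs * v                 ∎
      where open ≤-Reasoning

  -- The product x^∣s∣ · y^(e - ∣s∣). With x = a and y = b it is b^e times the probability that a
  -- random subset contains `s`; with x = a + 2a′ and y = 2b it is (2b)^e (1 - p/2)^∣s∣, where p =
  -- a/b and b = a + a′.
  weight : ℕ → ℕ → ∀ {e} → Subset e → ℕ
  weight x y []            = 1
  weight x y (inside  ∷ s) = x * weight x y s
  weight x y (outside ∷ s) = y * weight x y s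

  weight-∣∣ : ∀ x y {e} (s : Subset e) → weight x y s * y ^ ∣ s ∣ ≡ x ^ ∣ s ∣ * y ^ e
  weight-∣∣ x y []            = refl
  weight-∣∣ x y {suc e} (inside  ∷ s) =
    trans (exchange x (weight x y s) y (y ^ ∣ s ∣))
      (trans (cong (x * y *_) (weight-∣∣ x y s)) (exchange x y (x ^ ∣ s ∣) (y ^ e)))
    where
    exchange : ∀ a b c d → a * b * (c * d) ≡ a * c * (b * d)
    exchange = solve-∀
  weight-∣∣ x y {suc e} (outside ∷ s) =
    trans (*-assoc y (weight x y s) _) (trans (cong (y *_) (weight-∣∣ x y s)) (swap y (x ^ ∣ s ∣) (y ^ e)))
    where
    swap : ∀ a b c → a * (b * c) ≡ b * (a * c)
    swap = solve-∀

  -- A lower bound on ∣s∣ suffices, since every factor x beyond the first l may be replaced by the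
  -- larger y. This fits cycles, whose edge sets are only bounded below in size by their length.
  weight-≤ : ∀ {x y e l} (s : Subset e) .{{_ : NonZero y}} → x ≤ y → l ≤ ∣ s ∣ →
             weight x y s * y ^ l ≤ x ^ l * y ^ e
  weight-≤ {x} {y} {e} {l} s x≤y l≤s = *-cancelʳ-≤ _ _ (y ^ d) {{m^n≢0 y d}} (begin
    weight x y s * y ^ l * y ^ d      ≡⟨ *-assoc (weight x y s) _ _ ⟩
    weight x y s * (y ^ l * y ^ d)    ≡⟨ cong (weight x y s *_) (^-distribˡ-+-* y l d) ⟨
    weight x y s * y ^ (l + d)        ≡⟨ cong (λ k → weight x y s * y ^ k) l+d≡s ⟩
    weight x y s * y ^ ∣ s ∣          ≡⟨ weight-∣∣ x y s ⟩
    x ^ ∣ s ∣ * y ^ e                 ≡⟨ cong (λ k → x ^ k * y ^ e) l+d≡s ⟨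
    x ^ (l + d) * y ^ e               ≡⟨ cong (_* y ^ e) (^-distribˡ-+-* x l d) ⟩
    x ^ l * x ^ d * y ^ e             ≤⟨ *-monoˡ-≤ (y ^ e) (*-monoʳ-≤ (x ^ l) (^-monoˡ-≤ d x≤y)) ⟩
    x ^ l * y ^ d * y ^ e             ≡⟨ swap (x ^ l) (y ^ d) (y ^ e) ⟩
    x ^ l * y ^ e * y ^ d             ∎)
    where
    open ≤-Reasoning
    d = ∣ s ∣ ∸ l
    l+d≡s : l + d ≡ ∣ s ∣
    l+d≡s = m+[n∸m]≡n l≤s
    swap : ∀ a b c → a * b * c ≡ a * c * b
    swap = solve-∀

  -- 2^e times 2^(-∣s ∩ m∣): the scaling keeps a negative power of two in ℕ, and the recursion lets
  -- the expectation factor over the points.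
  damping : ∀ {e} → Subset e → Subset e → ℕ
  damping []            []            = 1
  damping (inside  ∷ m) (inside  ∷ s) = damping m s
  damping (inside  ∷ m) (outside ∷ s) = 2 * damping m s
  damping (outside ∷ m) (_       ∷ s) = 2 * damping m s

  damping-∩ : ∀ {e} (m s : Subset e) → damping m s * 2 ^ ∣ s ∩ m ∣ ≡ 2 ^ e
  damping-∩ []            []            = refl
  damping-∩ (inside  ∷ m) (inside  ∷ s) =
    trans (swap (damping m s) 2 (2 ^ ∣ s ∩ m ∣)) (cong (2 *_) (damping-∩ m s))
    where
    swap : ∀ a b c → a * (b * c) ≡ b * (a * c)
    swap = solve-∀
  damping-∩ (inside  ∷ m) (outside ∷ s) = trans (*-assoc 2 (damping m s) _) (cong (2 *_) (damping-∩ m s))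
  damping-∩ (outside ∷ m) (inside  ∷ s) = trans (*-assoc 2 (damping m s) _) (cong (2 *_) (damping-∩ m s))
  damping-∩ (outside ∷ m) (outside ∷ s) = trans (*-assoc 2 (damping m s) _) (cong (2 *_) (damping-∩ m s))

  -- The indicator of `t ⊆ s`, by recursion on the points so that its expectation is a product.
  containment : ∀ {e} → Subset e → Subset e → ℕ
  containment []            []            = 1
  containment (inside  ∷ t) (outside ∷ s) = 0
  containment (inside  ∷ t) (inside  ∷ s) = containment t s
  containment (outside ∷ t) (_       ∷ s) = containment t s

  containment-⊆ : ∀ {e} (t s : Subset e) → t ⊆ s → containment t s ≡ 1
  containment-⊆ []            []            _   = refl
  containment-⊆ (inside  ∷ t) (outside ∷ s) t⊆s with () ← t⊆s here
  containment-⊆ (inside  ∷ t) (inside  ∷ s) t⊆s = containment-⊆ t s (drop-∷-⊆ t⊆s)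
  containment-⊆ (outside ∷ t) (_       ∷ s) t⊆s = containment-⊆ t s (drop-∷-⊆ t⊆s)

  -- A random subset contains each point independently with probability a / (a + a′);
  -- expectations are scaled by (a + a′) ^ e to stay in ℕ.
  module Random (a a′ : ℕ) where

    b : ℕ
    b = a + a′

    𝔼 : ∀ {e} → (Subset e → ℕ) → ℕ
    𝔼 {zero}  f = f []
    𝔼 {suc e} f = a * 𝔼 (f ∘ (inside ∷_)) + a′ * 𝔼 (f ∘ (outside ∷_))

    𝔼-+ : ∀ {e} (f g : Subset e → ℕ) → 𝔼 (λ s → f s + g s) ≡ 𝔼 f + 𝔼 g
    𝔼-+ {zero}  f g = refl
    𝔼-+ {suc e} f g =
      trans (cong₂ (λ x y → a * x + a′ * y) (𝔼-+ (f ∘ (inside ∷_)) (g ∘ (inside ∷_)))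
                                            (𝔼-+ (f ∘ (outside ∷_)) (g ∘ (outside ∷_))))
        (regroup a a′ (𝔼 (f ∘ (inside ∷_))) _ _ _)
      where
      regroup : ∀ a a′ x y z w → a * (x + y) + a′ * (z + w) ≡ (a * x + a′ * z) + (a * y + a′ * w)
      regroup = solve-∀

    𝔼-* : ∀ {e} k (f : Subset e → ℕ) → 𝔼 (λ s → k * f s) ≡ k * 𝔼 f
    𝔼-* {zero}  k f = refl
    𝔼-* {suc e} k f =
      trans (cong₂ (λ x y → a * x + a′ * y) (𝔼-* k (f ∘ (inside ∷_))) (𝔼-* k (f ∘ (outside ∷_))))
        (regroup a a′ k _ _)
      where
      regroup : ∀ a a′ k x y → a * (k * x) + a′ * (k * y) ≡ k * (a * x + a′ * y)
      regroup = solve-∀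

    𝔼-0 : ∀ e → 𝔼 {e} (λ _ → 0) ≡ 0
    𝔼-0 e = 𝔼-* {e} 0 (λ _ → 0)

    𝔼-sum : ∀ {i} {I : Set i} {e} (f : I → Subset e → ℕ) xs →
            𝔼 (λ s → sum (map (λ x → f x s) xs)) ≡ sum (map (λ x → 𝔼 (f x)) xs)
    𝔼-sum {e = e} f [] = 𝔼-0 e
    𝔼-sum f (x ∷ xs) = trans (𝔼-+ (f x) _) (cong (𝔼 (f x) +_) (𝔼-sum f xs))

    -- The method of conditional expectations: membership is fixed point by point, and a weighted
    -- average below the bound has a branch below it.
    𝔼-< : ∀ {e} (f : Subset e → ℕ) k → 𝔼 f < k * b ^ e → ∃[ s ] f s < k
    𝔼-< {zero}  f k 𝔼f<k = [] , subst (f [] <_) (*-identityʳ k) 𝔼f<k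
    𝔼-< {suc e} f k 𝔼f<k with 𝔼 (f ∘ (inside ∷_)) <? k * b ^ e | 𝔼 (f ∘ (outside ∷_)) <? k * b ^ e
    ... | yes p | _     = let s , q = 𝔼-< (f ∘ (inside ∷_)) k p in inside ∷ s , q
    ... | no _  | yes p = let s , q = 𝔼-< (f ∘ (outside ∷_)) k p in outside ∷ s , q
    ... | no ¬p | no ¬q = ⊥-elim (<⇒≱ 𝔼f<k (begin
      k * (b * b ^ e)                                              ≡⟨ regroup a a′ k (b ^ e) ⟩
      a * (k * b ^ e) + a′ * (k * b ^ e)
        ≤⟨ +-mono-≤ (*-monoʳ-≤ a (≮⇒≥ ¬p)) (*-monoʳ-≤ a′ (≮⇒≥ ¬q)) ⟩
      a * 𝔼 (f ∘ (inside ∷_)) + a′ * 𝔼 (f ∘ (outside ∷_))          ∎))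
      where
      open ≤-Reasoning
      regroup : ∀ a a′ k x → k * ((a + a′) * x) ≡ a * (k * x) + a′ * (k * x)
      regroup = solve-∀

    -- By independence each point of `m` contributes the factor a · 1 + a′ · 2, and every other
    -- point contributes 2(a + a′).
    𝔼-damping : ∀ {e} (m : Subset e) → 𝔼 (damping m) ≡ weight (a + 2 * a′) (2 * b) m
    𝔼-damping []            = refl
    𝔼-damping (inside  ∷ m) =
      trans (cong (λ x → a * 𝔼 (damping m) + a′ * x) (𝔼-* 2 (damping m)))
        (trans (regroup a a′ _) (cong ((a + 2 * a′) *_) (𝔼-damping m)))
      where
      regroup : ∀ a a′ x → a * x + a′ * (2 * x) ≡ (a + 2 * a′) * x
      regroup = solve-∀
    𝔼-damping (outside ∷ m) =
      trans (cong (λ x → a * x + a′ * x) (𝔼-* 2 (damping m)))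
        (trans (regroup a a′ _) (cong (2 * b *_) (𝔼-damping m)))
      where
      regroup : ∀ a a′ x → a * (2 * x) + a′ * (2 * x) ≡ 2 * (a + a′) * x
      regroup = solve-∀

    𝔼-containment : ∀ {e} (t : Subset e) → 𝔼 (containment t) ≡ weight a b t
    𝔼-containment []                = refl
    𝔼-containment {suc e} (inside  ∷ t) =
      trans (cong₂ (λ x y → a * x + a′ * y) (𝔼-containment t) (𝔼-0 e))
        (trans (cong (a * weight a b t +_) (*-zeroʳ a′)) (+-identityʳ _))
    𝔼-containment (outside ∷ t)     =
      trans (sym (*-distribʳ-+ (𝔼 (containment t)) a a′)) (cong (b *_) (𝔼-containment t))

  -- Alteration: deleting points of a random subset

  nonempty-∣∣ : ∀ {e} (s : Subset e) → 0 < ∣ s ∣ → Nonempty s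
  nonempty-∣∣ {e} s 0<∣s∣ with nonempty? s
  ... | yes ne = ne
  ... | no em  = ⊥-elim (<⇒≢ 0<∣s∣ (sym (trans (cong ∣_∣ (Empty-unique em)) (∣⊥∣≡0 e))))

  x∉p-x : ∀ {e} (p : Subset e) x → x ∉ (p ∖ x)
  x∉p-x (_ ∷ p) zero    ()
  x∉p-x (_ ∷ p) (suc x) (there x∈) = x∉p-x p x x∈

  -- Deleting `zero` subtracts `⁅ zero ⁆ = inside ∷ ⊥`, so the tail appears as `p ─ ⊥` instead of
  -- `p`.
  ∣p∩q∣≤∣p─⊥∩q∣ : ∀ {e} (p q : Subset e) → ∣ p ∩ q ∣ ≤ ∣ (p ─ ⊥) ∩ q ∣
  ∣p∩q∣≤∣p─⊥∩q∣ p q = ≤-reflexive (cong (λ r → ∣ r ∩ q ∣) (sym (p─⊥≡p p)))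

  ∣p∩q∣≤1+∣p-x∩q∣ : ∀ {e} (p q : Subset e) x → ∣ p ∩ q ∣ ≤ suc ∣ (p ∖ x) ∩ q ∣
  ∣p∩q∣≤1+∣p-x∩q∣ (inside  ∷ p) (inside  ∷ q) zero    = s≤s (∣p∩q∣≤∣p─⊥∩q∣ p q)
  ∣p∩q∣≤1+∣p-x∩q∣ (inside  ∷ p) (outside ∷ q) zero    = m≤n⇒m≤1+n (∣p∩q∣≤∣p─⊥∩q∣ p q)
  ∣p∩q∣≤1+∣p-x∩q∣ (outside ∷ p) (_       ∷ q) zero    = m≤n⇒m≤1+n (∣p∩q∣≤∣p─⊥∩q∣ p q)
  ∣p∩q∣≤1+∣p-x∩q∣ (inside  ∷ p) (inside  ∷ q) (suc x) = s≤s (∣p∩q∣≤1+∣p-x∩q∣ p q x)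
  ∣p∩q∣≤1+∣p-x∩q∣ (inside  ∷ p) (outside ∷ q) (suc x) = ∣p∩q∣≤1+∣p-x∩q∣ p q x
  ∣p∩q∣≤1+∣p-x∩q∣ (outside ∷ p) (_       ∷ q) (suc x) = ∣p∩q∣≤1+∣p-x∩q∣ p q x

  module _ {e : ℕ} where

    contained : List (Subset e) → Subset e → ℕ
    contained ts s = sum (map (λ t → containment t s) ts)

    -- A point is removed only for a `t` that still lies in `s′`, hence in `s`, where it is counted
    -- by `contained`. Each removal costs any `m` at most one point, so the bound is uniform in `m`.
    destroy : (ts : List (Subset e)) → (∀ {t} → t ∈ₗ ts → Nonempty t) → (s : Subset e) →
      ∃[ s′ ] s′ ⊆ s × (∀ m → ∣ s ∩ m ∣ ≤ contained ts s + ∣ s′ ∩ m ∣) × (∀ {t} → t ∈ₗ ts → ¬ t ⊆ s′)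
    destroy []       _  s = s , (λ x∈s → x∈s) , (λ _ → ≤-refl) , λ ()
    destroy (t ∷ ts) ne s with destroy ts (ne ∘ there) s
    ... | s′ , s′⊆s , large , avoid with t ⊆? s′
    ...   | no t⊈s′ = s′ , s′⊆s , (λ m → ≤-trans (large m) (+-monoˡ-≤ ∣ s′ ∩ m ∣ (m≤n+m _ (containment t s))))
                    , λ { (here refl) → t⊈s′ ; (there t∈ts) → avoid t∈ts }
    ...   | yes t⊆s′ with x , x∈t ← ne (here refl) =
      s′ ∖ x , (λ y∈ → s′⊆s (p─q⊆p s′ ⁅ x ⁆ y∈)) , large′ ,
      λ { (here refl)  t⊆ → x∉p-x s′ x (t⊆ x∈t)
        ; (there t∈ts) t⊆ → avoid t∈ts (λ y∈t → p─q⊆p s′ ⁅ x ⁆ (t⊆ y∈t)) }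
      where
      open ≤-Reasoning
      large′ : ∀ m → ∣ s ∩ m ∣ ≤ contained (t ∷ ts) s + ∣ (s′ ∖ x) ∩ m ∣
      large′ m = begin
        ∣ s ∩ m ∣                                          ≤⟨ large m ⟩
        contained ts s + ∣ s′ ∩ m ∣
          ≤⟨ +-monoʳ-≤ (contained ts s) (∣p∩q∣≤1+∣p-x∩q∣ s′ m x) ⟩
        contained ts s + suc ∣ (s′ ∖ x) ∩ m ∣              ≡⟨ +-suc _ _ ⟩
        1 + contained ts s + ∣ (s′ ∖ x) ∩ m ∣
          ≡⟨ cong (λ c → c + contained ts s + ∣ (s′ ∖ x) ∩ m ∣) (containment-⊆ t s (s′⊆s ∘ t⊆s′)) ⟨
        contained (t ∷ ts) s + ∣ (s′ ∖ x) ∩ m ∣            ∎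

    -- Alteration: some outcome meets every m in ms in more than k points and contains
    -- fewer than k of the ts; then delete one point of each t that it contains.
    transversal : ∀ a a′ k (ms ts : List (Subset e)) → (∀ {t} → t ∈ₗ ts → Nonempty t) →
      let b = a + a′ in
      k * 2 ^ k * sum (map (weight (a + 2 * a′) (2 * b)) ms) + 2 ^ e * sum (map (weight a b) ts)
        < k * 2 ^ e * b ^ e →
      ∃[ s ] (∀ {m} → m ∈ₗ ms → Nonempty (s ∩ m)) × (∀ {t} → t ∈ₗ ts → ¬ t ⊆ s)
    transversal a a′ k ms ts ne small =
      let s , fs<    = 𝔼-< f (k * 2 ^ e) (subst (_< k * 2 ^ e * b ^ e) (sym 𝔼f) small)
          s′ , _ , large , avoid = destroy ts ne s
      in s′ , (λ {m} m∈ms → nonempty-∣∣ (s′ ∩ m) (+-cancelˡ-< (contained ts s) 0 _ (begin-strict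
           contained ts s + 0             ≡⟨ +-identityʳ _ ⟩
           contained ts s                 <⟨ few s fs< ⟩
           k                              <⟨ many s fs< m∈ms ⟩
           ∣ s ∩ m ∣                      ≤⟨ large m ⟩
           contained ts s + ∣ s′ ∩ m ∣    ∎))) , avoid
      where
      open ≤-Reasoning
      open Random a a′
      c = k * 2 ^ k
      D : Subset e → ℕ
      D s = sum (map (λ m → damping m s) ms)
      -- `f s` is k · 2^e times the sum of all 2^(k - ∣s ∩ m∣) plus (number of contained `t`) / k;
      -- the goal is to make that quantity less than 1.
      f : Subset e → ℕ
      f s = c * D s + 2 ^ e * contained ts s

      𝔼f : 𝔼 f ≡ c * sum (map (weight (a + 2 * a′) (2 * b)) ms) + 2 ^ e * sum (map (weight a b) ts)
      𝔼f = trans (𝔼-+ (λ s → c * D s) (λ s → 2 ^ e * contained ts s)) (cong₂ _+_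
        (trans (𝔼-* c D) (cong (c *_) (trans (𝔼-sum damping ms) (cong sum (map-cong 𝔼-damping ms)))))
        (trans (𝔼-* (2 ^ e) (contained ts)) (cong (2 ^ e *_)
          (trans (𝔼-sum containment ts) (cong sum (map-cong 𝔼-containment ts))))))

      few : ∀ s → f s < k * 2 ^ e → contained ts s < k
      few s fs< = *-cancelˡ-< (2 ^ e) _ _ (begin-strict
        2 ^ e * contained ts s    ≤⟨ m≤n+m _ (c * D s) ⟩
        f s                       <⟨ fs< ⟩
        k * 2 ^ e                 ≡⟨ *-comm k _ ⟩
        2 ^ e * k                 ∎)

      many : ∀ s → f s < k * 2 ^ e → ∀ {m} → m ∈ₗ ms → k < ∣ s ∩ m ∣
      -- A single `m` meeting `s` in at most `k` points would already contribute k · 2^e.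
      many s fs< {m} m∈ms = ≰⇒> λ ∣s∩m∣≤k → <⇒≱ (begin-strict
        k * (2 ^ k * damping m s)    ≡⟨ *-assoc k (2 ^ k) _ ⟨
        c * damping m s              ≤⟨ *-monoʳ-≤ c (sum-map-∈ (λ m → damping m s) m∈ms) ⟩
        c * D s                      ≤⟨ m≤m+n _ _ ⟩
        f s                          <⟨ fs< ⟩
        k * 2 ^ e                    ∎) (*-monoʳ-≤ k (begin
        2 ^ e                           ≡⟨ damping-∩ m s ⟨
        damping m s * 2 ^ ∣ s ∩ m ∣     ≡⟨ *-comm (damping m s) _ ⟩
        2 ^ ∣ s ∩ m ∣ * damping m s     ≤⟨ *-monoˡ-≤ (damping m s) (^-monoʳ-≤ 2 ∣s∩m∣≤k) ⟩
        2 ^ k * damping m s             ∎))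

  -- Sets of vertex pairs

  injection⇒≤∣∣ : ∀ {k e} (s : Subset e) (f : Fin k → Fin e) →
                  Injective _≡_ _≡_ f → (∀ i → f i ∈ s) → k ≤ ∣ s ∣
  injection⇒≤∣∣ {zero}  s f inj f∈s = z≤n
  injection⇒≤∣∣ {suc k} s f inj f∈s = ≤-trans
    (s≤s (injection⇒≤∣∣ (s ∖ f zero) (f ∘ suc) (Finₚ.suc-injective ∘ inj)
      λ i → x∈p∧x≢y⇒x∈p-y (f∈s (suc i)) (λ eq → Finₚ.0≢1+n (sym (inj eq)))))
    (x∈p⇒∣p-x∣<∣p∣ (f∈s zero))

  ∈-tabulate⁺ : ∀ {e} {f : Fin e → Bool} {x} → f x ≡ true → x ∈ tabulate f
  ∈-tabulate⁺ {f = f} {x} fx = lookup⇒[]= x (tabulate f) (trans (lookup∘tabulate f x) fx)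

  ∈-tabulate⁻ : ∀ {e} {f : Fin e → Bool} {x} → x ∈ tabulate f → f x ≡ true
  ∈-tabulate⁻ {f = f} {x} x∈ = trans (sym (lookup∘tabulate f x)) ([]=⇒lookup x∈)

  ∣tabulate∣-+ : ∀ m {n} (f : Fin (m + n) → Bool) →
    ∣ tabulate f ∣ ≡ ∣ tabulate (f ∘ (_↑ˡ n)) ∣ + ∣ tabulate (f ∘ (m ↑ʳ_)) ∣
  ∣tabulate∣-+ zero    f = refl
  ∣tabulate∣-+ (suc m) f with f zero
  ... | true  = cong suc (∣tabulate∣-+ m (f ∘ suc))
  ... | false = ∣tabulate∣-+ m (f ∘ suc)

  -- The pairs u < v in Fin n, indexed so that those containing zero come first.
  pairs : ℕ → ℕ
  pairs zero    = 0
  pairs (suc n) = n + pairs n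

  endpoints : ∀ n → Fin (pairs n) → Fin n × Fin n
  endpoints (suc n) x = [ (λ j → zero , suc j) , (λ y → map× suc suc (endpoints n y)) ]′ (splitAt n x)

  endpoints-< : ∀ n x → proj₁ (endpoints n x) Fin.< proj₂ (endpoints n x)
  endpoints-< (suc n) x with splitAt n x
  ... | inj₁ j = z<s
  ... | inj₂ y = s<s (endpoints-< n y)

  endpoints-injective : ∀ n {x y} → endpoints n x ≡ endpoints n y → x ≡ y
  endpoints-injective (suc n) {x} {y} eq with splitAt n x in p | splitAt n y in q
  ... | inj₁ i | inj₁ j = trans (sym (splitAt⁻¹-↑ˡ p))
    (trans (cong (_↑ˡ pairs n) (Finₚ.suc-injective (cong proj₂ eq))) (splitAt⁻¹-↑ˡ q))
  ... | inj₁ i | inj₂ j with () ← cong proj₁ eq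
  ... | inj₂ i | inj₁ j with () ← cong proj₁ eq
  ... | inj₂ i | inj₂ j = trans (sym (splitAt⁻¹-↑ʳ p))
    (trans (cong (n ↑ʳ_) (endpoints-injective n
      (cong₂ _,_ (Finₚ.suc-injective (cong proj₁ eq)) (Finₚ.suc-injective (cong proj₂ eq)))))
      (splitAt⁻¹-↑ʳ q))

  Joins : ∀ {n} → Fin (pairs n) → Fin n → Fin n → Set
  Joins {n} x u v = endpoints n x ≡ (u , v) ⊎ endpoints n x ≡ (v , u)

  joining : ∀ {n} (u v : Fin n) → u ≢ v → ∃[ x ] Joins x u v
  joining         zero    zero    u≢v = ⊥-elim (u≢v refl)
  joining {suc n} zero    (suc v) u≢v = v ↑ˡ pairs n , inj₁ (cong [ _ , _ ]′ (splitAt-↑ˡ n v (pairs n)))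
  joining {suc n} (suc u) zero    u≢v = u ↑ˡ pairs n , inj₂ (cong [ _ , _ ]′ (splitAt-↑ˡ n u (pairs n)))
  joining {suc n} (suc u) (suc v) u≢v with joining u v (u≢v ∘ cong suc)
  ... | x , inj₁ eq = n ↑ʳ x ,
    inj₁ (trans (cong [ _ , _ ]′ (splitAt-↑ʳ n (pairs n) x)) (cong (map× suc suc) eq))
  ... | x , inj₂ eq = n ↑ʳ x ,
    inj₂ (trans (cong [ _ , _ ]′ (splitAt-↑ʳ n (pairs n) x)) (cong (map× suc suc) eq))

  -- Each index stores its pair in increasing order, so two indices cannot carry the same pair in
  -- opposite orders.
  joins-unique : ∀ {n x y} {u v : Fin n} → Joins x u v → Joins y u v → x ≡ y
  joins-unique {n} (inj₁ p) (inj₁ q) = endpoints-injective n (trans p (sym q))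
  joins-unique {n} (inj₂ p) (inj₂ q) = endpoints-injective n (trans p (sym q))
  joins-unique {n} {x} {y} (inj₁ p) (inj₂ q) = ⊥-elim (Finₚ.<-asym (endpoints-< n x)
    (subst (λ e → proj₁ e Fin.< proj₂ e) (trans q (sym (cong swap× p))) (endpoints-< n y)))
  joins-unique {n} {x} {y} (inj₂ p) (inj₁ q) = ⊥-elim (Finₚ.<-asym (endpoints-< n x)
    (subst (λ e → proj₁ e Fin.< proj₂ e) (trans q (sym (cong swap× p))) (endpoints-< n y)))

  edges : ∀ {n} → (Fin n → Fin n → Bool) → Subset (pairs n)
  edges {n} P = tabulate (uncurry P ∘ endpoints n)

  ∣edges∣-suc : ∀ {n} (P : Fin (suc n) → Fin (suc n) → Bool) →
    ∣ edges P ∣ ≡ ∣ tabulate (P zero ∘ suc) ∣ + ∣ edges (λ u v → P (suc u) (suc v)) ∣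
  ∣edges∣-suc {n} P = trans (∣tabulate∣-+ n _) (cong₂ _+_
    (cong ∣_∣ (tabulate-cong λ j → cong (λ z → uncurry P ([ _ , _ ]′ z)) (splitAt-↑ˡ n j (pairs n))))
    (cong ∣_∣ (tabulate-cong λ y → cong (λ z → uncurry P ([ _ , _ ]′ z)) (splitAt-↑ʳ n (pairs n) y))))

  -- Counting monochromatic edges

  -- The changed entry is added on both sides to avoid subtraction. It is applied to squares and to
  -- the identity, the two sums in `cost`.
  ∑-updateAt : ∀ {q} (g : ℕ → ℕ) (x : Vector ℕ q) i →
    ∑ (g ∘ updateAt x i suc) + g (x i) ≡ ∑ (g ∘ x) + g (suc (x i))
  ∑-updateAt g x zero    = rotate (g (suc (x zero))) (∑ (g ∘ tail x)) (g (x zero))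
    where
    rotate : ∀ a b c → a + b + c ≡ c + b + a
    rotate = solve-∀
  ∑-updateAt g x (suc i) = trans (+-assoc (g (x zero)) _ _)
    (trans (cong (g (x zero) +_) (∑-updateAt g (tail x) i)) (sym (+-assoc (g (x zero)) _ _)))

  ≤-updateAt : ∀ {q} (x : Vector ℕ q) i j → x j ≤ updateAt x i suc j
  ≤-updateAt x zero    zero    = n≤1+n _
  ≤-updateAt x zero    (suc j) = ≤-refl
  ≤-updateAt x (suc i) zero    = ≤-refl
  ≤-updateAt x (suc i) (suc j) = ≤-updateAt (tail x) i j

  sq : ℕ → ℕ
  sq x = x * x

  -- `palette i` is the number of colours given to class i, and `colour v` is an index within the
  -- class of `v`. Without subtraction, `cost` says that the binomials (x_i choose 2) over the
  -- palette sizes x_i add up to at most the number of edges.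
  record Refinement {n q} (P : Fin n → Fin n → Bool) (c : Fin n → Fin q) : Set where
    field
      palette : Vector ℕ q
      colour  : Fin n → ℕ
      bounded : ∀ v → colour v < palette (c v)
      proper  : ∀ x → uncurry P (endpoints n x) ≡ true →
                colour (proj₁ (endpoints n x)) ≢ colour (proj₂ (endpoints n x))
      cost    : ∑ (sq ∘ palette) ≤ 2 * ∣ edges P ∣ + ∑ palette

  -- Greedy colouring: a vertex receives a new colour of its class only if all y colours of
  -- that class occur on its neighbours, so the y-th new colour is paid for by y edges.
  refine : ∀ {n q} (P : Fin n → Fin n → Bool) (c : Fin n → Fin q) →
           (∀ u v → P u v ≡ true → c u ≡ c v) → Refinement P c
  refine {zero} {q} P c mono = record
    { palette = λ _ → 0 ; colour = λ () ; bounded = λ () ; proper = λ ()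
    ; cost = ≤-reflexive refl }
  refine {suc n} {q} P c mono = extend (all? used?)
    where
    open ≤-Reasoning
    P′ = λ u v → P (suc u) (suc v)
    -- The vertices `suc v` are coloured first, and `zero` is then added to them.
    open Refinement (refine P′ (c ∘ suc) (λ u v → mono (suc u) (suc v)))
    y = palette (c zero)
    deg = ∣ tabulate (P zero ∘ suc) ∣

    Used : Fin y → Set
    Used k = ∃[ v ] P zero (suc v) ≡ true × colour v ≡ toℕ k

    used? : ∀ k → Dec (Used k)
    used? k = any? λ v → (P zero (suc v) Bool.≟ true) ×-dec (colour v ≟ toℕ k)

    with-colour : ℕ → Fin (suc n) → ℕ
    with-colour k zero    = k
    with-colour k (suc v) = colour v

    proper′ : ∀ k → (∀ v → P zero (suc v) ≡ true → k ≢ colour v) →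
      ∀ x → uncurry P (endpoints (suc n) x) ≡ true →
      with-colour k (proj₁ (endpoints (suc n) x)) ≢ with-colour k (proj₂ (endpoints (suc n) x))
    proper′ k new x with splitAt n x
    ... | inj₁ j = new j
    ... | inj₂ z = proper z

    regroup : ∀ d e s → 2 * e + s + 2 * d ≡ 2 * (d + e) + s
    regroup = solve-∀

    extend : Dec (∀ k → Used k) → Refinement P c
    extend (no ¬all) with k , unused ← ¬∀⟶∃¬ y Used used? ¬all = record
      { palette = palette
      ; colour  = with-colour (toℕ k)
      ; bounded = λ { zero → toℕ<n k ; (suc v) → bounded v }
      ; proper  = proper′ (toℕ k) (λ v Pv eq → unused (v , Pv , sym eq))
      ; cost    = begin
          ∑ (sq ∘ palette)                           ≤⟨ cost ⟩
          2 * ∣ edges P′ ∣ + ∑ palette               ≤⟨ m≤m+n _ (2 * deg) ⟩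
          2 * ∣ edges P′ ∣ + ∑ palette + 2 * deg     ≡⟨ regroup deg _ _ ⟩
          2 * (deg + ∣ edges P′ ∣) + ∑ palette
            ≡⟨ cong (λ e → 2 * e + ∑ palette) (∣edges∣-suc P) ⟨
          2 * ∣ edges P ∣ + ∑ palette                ∎
      }
    extend (yes all) = record
      { palette = palette′
      ; colour  = with-colour y
      ; bounded = λ { zero → ≤-reflexive (sym (updateAt-updates (c zero) palette))
                    ; (suc v) → ≤-trans (bounded v) (≤-updateAt palette (c zero) (c (suc v))) }
      ; proper  = proper′ y (λ v Pv eq → <⇒≢ (bounded v)
                    (trans (sym eq) (cong palette (mono zero (suc v) Pv))))
      -- Passing from y to y + 1 colours raises the sum of squares minus the sum by 2y, which the at
      -- least y edges at `zero` pay for.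
      ; cost    = +-cancelʳ-≤ (sq y) _ _ (begin
          ∑ (sq ∘ palette′) + sq y
            ≡⟨ ∑-updateAt sq palette (c zero) ⟩
          ∑ (sq ∘ palette) + sq (suc y)                             ≤⟨ +-monoˡ-≤ (sq (suc y)) cost ⟩
          2 * ∣ edges P′ ∣ + ∑ palette + sq (suc y)
            ≡⟨ expand (2 * ∣ edges P′ ∣) (∑ palette) y ⟩
          2 * ∣ edges P′ ∣ + (∑ palette + suc y) + y + sq y
            ≡⟨ cong (λ s → 2 * ∣ edges P′ ∣ + s + y + sq y) (∑-updateAt (λ z → z) palette (c zero)) ⟨
          2 * ∣ edges P′ ∣ + (∑ palette′ + y) + y + sq y
            ≡⟨ cong (_+ sq y) (collect ∣ edges P′ ∣ (∑ palette′) y) ⟩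
          2 * (y + ∣ edges P′ ∣) + ∑ palette′ + sq y
            ≤⟨ +-monoˡ-≤ (sq y) (+-monoˡ-≤ (∑ palette′) (*-monoʳ-≤ 2 (+-monoˡ-≤ ∣ edges P′ ∣ y≤deg))) ⟩
          2 * (deg + ∣ edges P′ ∣) + ∑ palette′ + sq y
            ≡⟨ cong (λ e → 2 * e + ∑ palette′ + sq y) (∣edges∣-suc P) ⟨
          2 * ∣ edges P ∣ + ∑ palette′ + sq y                       ∎)
      }
      where
      palette′ = updateAt palette (c zero) suc
      y≤deg : y ≤ deg
      -- Every used colour has a neighbour of `zero` bearing it, and different colours have
      -- different neighbours.
      y≤deg = injection⇒≤∣∣ (tabulate (P zero ∘ suc)) (proj₁ ∘ all)
        (λ {k} {l} eq → toℕ-injective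
          (trans (sym (proj₂ (proj₂ (all k)))) (trans (cong colour eq) (proj₂ (proj₂ (all l))))))
        (λ k → ∈-tabulate⁺ (proj₁ (proj₂ (all k))))
      expand : ∀ e s y → e + s + suc y * suc y ≡ e + (s + suc y) + y + y * y
      expand = solve-∀
      collect : ∀ e s y → 2 * e + (s + y) + y ≡ 2 * (y + e) + s
      collect = solve-∀

  -- Turns a pair (class, colour within the class) into one colour of the disjoint union of all
  -- palettes.
  inject : ∀ {q} (x : Vector ℕ q) i → Fin (x i) → Fin (∑ x)
  inject x zero    k = k ↑ˡ ∑ (tail x)
  inject x (suc i) k = x zero ↑ʳ inject (tail x) i k

  inject-injective : ∀ {q} (x : Vector ℕ q) i j {k l} →
                     inject x i k ≡ inject x j l → i ≡ j × toℕ k ≡ toℕ l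
  inject-injective x zero zero {k} {l} eq = refl ,
    trans (sym (toℕ-↑ˡ k _)) (trans (cong toℕ eq) (toℕ-↑ˡ l _))
  inject-injective x zero (suc j) {k} eq
    with () ← trans (sym (splitAt-↑ˡ (x zero) k _))
      (trans (cong (splitAt (x zero)) eq) (splitAt-↑ʳ (x zero) _ _))
  inject-injective x (suc i) zero {l = l} eq
    with () ← trans (sym (splitAt-↑ʳ (x zero) _ _))
      (trans (cong (splitAt (x zero)) eq) (splitAt-↑ˡ (x zero) l _))
  inject-injective x (suc i) (suc j) eq =
    let i≡j , k≡l = inject-injective (tail x) i j (↑ʳ-injective (x zero) _ _ eq)
    in cong suc i≡j , k≡l

  2xy≤x²+y² : ∀ x y → 2 * (x * y) ≤ sq x + sq y
  2xy≤x²+y² x y with ≤-total x y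
  ... | inj₁ x≤y = subst (λ z → 2 * (x * z) ≤ sq x + sq z) (m+[n∸m]≡n x≤y) (below x (y ∸ x))
    where
    below : ∀ x d → 2 * (x * (x + d)) ≤ sq x + sq (x + d)
    below x d = subst (2 * (x * (x + d)) ≤_) (expand x d) (m≤m+n _ (d * d))
      where
      expand : ∀ x d → 2 * (x * (x + d)) + d * d ≡ x * x + (x + d) * (x + d)
      expand = solve-∀
  ... | inj₂ y≤x = subst (λ z → 2 * (z * y) ≤ sq z + sq y) (m+[n∸m]≡n y≤x) (above y (x ∸ y))
    where
    above : ∀ y d → 2 * ((y + d) * y) ≤ sq (y + d) + sq y
    above y d = subst (2 * ((y + d) * y) ≤_) (expand y d) (m≤m+n _ (d * d))
      where
      expand : ∀ y d → 2 * ((y + d) * y) + d * d ≡ (y + d) * (y + d) + y * y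
      expand = solve-∀

  -- The bound 2tx ≤ x² + t² summed over the entries. With t the first entry it controls the cross
  -- terms in the induction for `cauchy-schwarz`.
  ∑-tangent : ∀ {q} t (x : Vector ℕ q) → 2 * (t * ∑ x) ≤ ∑ (sq ∘ x) + q * sq t
  ∑-tangent {zero}  t x = ≤-reflexive (cong (2 *_) (*-zeroʳ t))
  ∑-tangent {suc q} t x = begin
    2 * (t * (x zero + ∑ (tail x)))
      ≡⟨ distrib t (x zero) (∑ (tail x)) ⟩
    2 * (x zero * t) + 2 * (t * ∑ (tail x))
      ≤⟨ +-mono-≤ (2xy≤x²+y² (x zero) t) (∑-tangent t (tail x)) ⟩
    sq (x zero) + sq t + (∑ (sq ∘ tail x) + q * sq t)
      ≡⟨ regroup (sq (x zero)) (sq t) (∑ (sq ∘ tail x)) (q * sq t) ⟩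
    sq (x zero) + ∑ (sq ∘ tail x) + (sq t + q * sq t)             ∎
    where
    open ≤-Reasoning
    distrib : ∀ t a b → 2 * (t * (a + b)) ≡ 2 * (a * t) + 2 * (t * b)
    distrib = solve-∀
    regroup : ∀ a b c d → a + b + (c + d) ≡ a + c + (b + d)
    regroup = solve-∀

  cauchy-schwarz : ∀ {q} (x : Vector ℕ q) → sq (∑ x) ≤ q * ∑ (sq ∘ x)
  cauchy-schwarz {zero}  x = z≤n
  cauchy-schwarz {suc q} x = begin
    sq (x zero + ∑ (tail x))
      ≡⟨ expand (x zero) (∑ (tail x)) ⟩
    sq (x zero) + 2 * (x zero * ∑ (tail x)) + sq (∑ (tail x))
      ≤⟨ +-mono-≤ (+-monoʳ-≤ (sq (x zero)) (∑-tangent (x zero) (tail x))) (cauchy-schwarz (tail x)) ⟩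
    sq (x zero) + (∑ (sq ∘ tail x) + q * sq (x zero)) + q * ∑ (sq ∘ tail x)
      ≡⟨ collect q (sq (x zero)) (∑ (sq ∘ tail x)) ⟩
    suc q * (sq (x zero) + ∑ (sq ∘ tail x))                                       ∎
    where
    open ≤-Reasoning
    expand : ∀ a b → (a + b) * (a + b) ≡ a * a + 2 * (a * b) + b * b
    expand = solve-∀
    collect : ∀ q a b → a + (b + q * a) + q * b ≡ suc q * (a + b)
    collect = solve-∀

  module _ {n : ℕ} (J : Graph n) where
    open Graph J

    monochromatic : ∀ {q} → (Fin n → Fin q) → Fin n → Fin n → Bool
    monochromatic c u v = ⌊ (u ~? v) ×-dec (c u Fin.≟ c v) ⌋

    monochromatic⁺ : ∀ {q} (c : Fin n → Fin q) {u v} → u ~ v → c u ≡ c v → monochromatic c u v ≡ true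
    monochromatic⁺ c {u} {v} u~v cu≡cv = trans (isYes≗does d?) (dec-true d? (u~v , cu≡cv))
      where d? = (u ~? v) ×-dec (c u Fin.≟ c v)

    monochromatic⁻ : ∀ {q} (c : Fin n → Fin q) {u v} → monochromatic c u v ≡ true → u ~ v × c u ≡ c v
    monochromatic⁻ c {u} {v} eq with (u ~? v) ×-dec (c u Fin.≟ c v)
    ... | yes p = p

    monochromaticEdges : ∀ {q} → (Fin n → Fin q) → Subset (pairs n)
    monochromaticEdges c = edges (monochromatic c)

    -- Pairing each class with its refined colours colours `J` properly with X colours, so X ≥ q +
    -- d. Cauchy-Schwarz and `cost` give X² ≤ q(2e + X), that is X(X - q) ≤ 2qe, and the left side
    -- is at least d².
    ∣monochromaticEdges∣-≥ : ∀ {q d} → (∀ k → Colourable J k → q + d ≤ k) → (c : Fin n → Fin q) →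
                             sq d ≤ 2 * q * ∣ monochromaticEdges c ∣
    ∣monochromaticEdges∣-≥ {q} {d} minimal c = +-cancelˡ-≤ (q * X) _ _ (begin
      q * X + d * d
        ≤⟨ +-mono-≤ (*-monoʳ-≤ q (≤-reflexive (sym X≡))) (*-mono-≤ (m≤m+n d f) (m≤n+m d (q + f))) ⟩
      q * (q + d + f) + (d + f) * (q + f + d)   ≡⟨ expand q d f ⟩
      sq (q + d + f)                ≡⟨ cong sq X≡ ⟩
      sq X                          ≤⟨ cauchy-schwarz palette ⟩
      q * ∑ (sq ∘ palette)          ≤⟨ *-monoʳ-≤ q cost ⟩
      q * (2 * e + X)               ≡⟨ collect q e X ⟩
      q * X + 2 * q * e             ∎)
      where
      open ≤-Reasoning
      open Refinement (refine (monochromatic c) c (λ u v → proj₂ ∘ monochromatic⁻ c))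
      X = ∑ palette
      e = ∣ monochromaticEdges c ∣

      d′ : Fin n → Fin X
      d′ v = inject palette (c v) (fromℕ< (bounded v))

      colour-proper : ∀ {u v} → u ~ v → c u ≡ c v → colour u ≢ colour v
      colour-proper {u} {v} u~v cu≡cv with joining u v (λ u≡v → irrefl u≡v u~v)
      ... | x , inj₁ eq = subst (λ (u , v) → colour u ≢ colour v) eq
              (proper x (trans (cong (uncurry (monochromatic c)) eq) (monochromatic⁺ c u~v cu≡cv)))
      ... | x , inj₂ eq = ≢-sym (subst (λ (v , u) → colour v ≢ colour u) eq
              (proper x (trans (cong (uncurry (monochromatic c)) eq)
                (monochromatic⁺ c (symm u~v) (sym cu≡cv)))))

      d′-proper : ∀ u v → u ~ v → d′ u ≢ d′ v
      d′-proper u v u~v eq with inject-injective palette (c u) (c v) eq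
      ... | cu≡cv , k≡l = colour-proper u~v cu≡cv
        (trans (sym (toℕ-fromℕ< (bounded u))) (trans k≡l (toℕ-fromℕ< (bounded v))))

      m≤X : q + d ≤ X
      m≤X = minimal X (d′ , d′-proper)
      f = X ∸ (q + d)
      X≡ : q + d + f ≡ X
      X≡ = m+[n∸m]≡n m≤X
      expand : ∀ q d f → q * (q + d + f) + (d + f) * (q + f + d) ≡ (q + d + f) * (q + d + f)
      expand = solve-∀
      collect : ∀ q e X → q * (2 * e + X) ≡ q * X + 2 * q * e
      collect = solve-∀

  -- Existence of the chromatic number and the girth

  least : ∀ {P : ℕ → Set} → (∀ k → Dec (P k)) → ∀ {n} → P n → ∃[ k ] P k × (∀ j → P j → k ≤ j)
  least P? {n} Pn with P? 0
  ... | yes P0 = 0 , P0 , λ _ _ → z≤n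
  least P? {zero}  Pn | no ¬P0 = ⊥-elim (¬P0 Pn)
  least P? {suc n} Pn | no ¬P0 with k , Pk , minimal ← least (P? ∘ suc) Pn =
    suc k , Pk , λ { zero P0 → ⊥-elim (¬P0 P0) ; (suc j) Pj → s≤s (minimal j Pj) }

  ∈-vertexTuples : ∀ {n ℓ} (v : Vec (Fin n) ℓ) → v ∈ₗ vertexTuples n ℓ
  ∈-vertexTuples []      = here refl
  ∈-vertexTuples (x ∷ v) = ∈-cartesianProductWith⁺ _∷_ (∈-allFin x) (∈-vertexTuples v)

  length-cartesianProductWith : ∀ {a b c} {A : Set a} {B : Set b} {C : Set c} (f : A → B → C) xs ys →
                                length (cartesianProductWith f xs ys) ≡ length xs * length ys
  length-cartesianProductWith f []       ys = refl
  length-cartesianProductWith f (x ∷ xs) ys = trans (length-++ (map (f x) ys))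
    (cong₂ _+_ (length-map (f x) ys) (length-cartesianProductWith f xs ys))

  length-vertexTuples : ∀ n ℓ → length (vertexTuples n ℓ) ≡ n ^ ℓ
  length-vertexTuples n zero    = refl
  length-vertexTuples n (suc ℓ) = trans (length-cartesianProductWith _∷_ (allFin n) (vertexTuples n ℓ))
    (cong₂ _*_ (length-tabulate {n = n} id) (length-vertexTuples n ℓ))

  sum-map-concat : ∀ {a} {A : Set a} (g : A → ℕ) (f : ℕ → List A) k →
    sum (map g (concat (applyUpTo f k))) ≡ sum (applyUpTo (λ i → sum (map g (f i))) k)
  sum-map-concat g f zero    = refl
  sum-map-concat g f (suc k) = trans (cong sum (map-++ g (f 0) _))
    (trans (sum-++ (map g (f 0)) _) (cong (sum (map g (f 0)) +_) (sum-map-concat g (f ∘ suc) k)))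

  module _ {n : ℕ} (G : Graph n) where
    open Graph G

    colourable? : ∀ k → Dec (Colourable G k)
    colourable? k = map′ (λ any → let c , _ , proper = find any in lookup c , proper) to
      (anyₗ? (λ c → all? λ u → all? λ v → (u ~? v) →-dec ¬? (lookup c u Fin.≟ lookup c v)) (vertexTuples k n))
      where
      to : Colourable G k → _
      to (c , proper) = lose (∈-vertexTuples (tabulate c)) λ u v u~v eq →
        proper u v u~v (trans (sym (lookup∘tabulate c u)) (trans eq (lookup∘tabulate c v)))

    chromaticNumber : ∃[ χ ] IsChromaticNumber G χ
    chromaticNumber = least colourable? {n} (id , λ u v u~v u≡v → irrefl u≡v u~v)

    hasCycle? : ∀ ℓ → Dec (HasCycle G ℓ)
    hasCycle? ℓ = map′ (λ any → let v , _ , cyc = find any in v , cyc)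
      (λ (v , cyc) → lose (∈-vertexTuples v) cyc)
      (anyₗ? (isCycle? G) (vertexTuples n ℓ))

    cycle-length-≤ : ∀ {ℓ} → HasCycle G ℓ → ℓ ≤ n
    cycle-length-≤ (v , _ , inj , _) = Finₚ.injective⇒≤ (λ {i} {j} → inj i j)

    -- A cycle has at most n vertices, so a search through the lengths 0 to n decides whether the
    -- girth is finite.
    girth-≥ : ∀ r → (∀ ℓ → HasCycle G ℓ → r ≤ ℓ) → ∃[ g ] IsGirth G g × fin r ≤⁺ g
    girth-≥ r long with any? {n = suc n} (hasCycle? ∘ toℕ)
    ... | yes (_ , cyc) with g , cyc-g , minimal ← least hasCycle? cyc =
            fin g , (cyc-g , minimal) , [ long g cyc-g ]
    ... | no acyclic = ⊤⁺ , (λ ℓ cyc → acyclic (fromℕ< (s≤s (cycle-length-≤ cyc)) ,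
            subst (HasCycle G) (sym (toℕ-fromℕ< (s≤s (cycle-length-≤ cyc)))) cyc)) , (fin r ≤⊤⁺)

  -- Cycles as edge sets

  toℕ-next-< : ∀ {ℓ} (i : Fin ℓ) → suc (toℕ i) < ℓ → toℕ (next i) ≡ suc (toℕ i)
  toℕ-next-< {suc ℓ} i i< = trans (toℕ-fromℕ< (m%n<n (suc (toℕ i)) (suc ℓ))) (m<n⇒m%n≡m i<)

  toℕ-next-last : ∀ {ℓ} (i : Fin ℓ) → suc (toℕ i) ≡ ℓ → toℕ (next i) ≡ 0
  toℕ-next-last {suc ℓ} i eq = trans (toℕ-fromℕ< (m%n<n (suc (toℕ i)) (suc ℓ)))
    (trans (cong (_% suc ℓ) eq) (n%n≡0 (suc ℓ)))

  -- Rules out that a cycle traverses one edge in both directions. Two steps return to the start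
  -- only in `Fin 1` and `Fin 2`, and the cases follow where the wrap-around to 0 occurs.
  next∘next-≢ : ∀ {ℓ} → 3 ≤ ℓ → (i : Fin ℓ) → next (next i) ≢ i
  next∘next-≢ {ℓ} 3≤ℓ i eq with m≤n⇒m<n∨m≡n (toℕ<n i)
  ... | inj₂ last = <⇒≢ 3≤ℓ (trans (cong suc (sym i≡1)) last)
    where
    next≡0 = toℕ-next-last i last
    i≡1 : toℕ i ≡ 1
    i≡1 = trans (cong toℕ (sym eq)) (trans (toℕ-next-< (next i)
      (subst (λ t → suc t < ℓ) (sym next≡0) (<⇒≤ 3≤ℓ))) (cong suc next≡0))
  ... | inj₁ i+1<ℓ with m≤n⇒m<n∨m≡n i+1<ℓ
  ...   | inj₁ i+2<ℓ = <⇒≢ (m<n+m (toℕ i) {2} z<s) (sym (trans (cong suc (sym n≡)) (trans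
            (sym (toℕ-next-< (next i) (subst (λ t → suc t < ℓ) (sym n≡) i+2<ℓ))) (cong toℕ eq))))
    where n≡ = toℕ-next-< i i+1<ℓ
  ...   | inj₂ i+2≡ℓ = <⇒≢ 3≤ℓ (trans (cong 2+ (sym i≡0)) i+2≡ℓ)
    where
    i≡0 : toℕ i ≡ 0
    i≡0 = trans (cong toℕ (sym eq)) (toℕ-next-last (next i) (trans (cong suc (toℕ-next-< i i+1<ℓ)) i+2≡ℓ))

  entry : ∀ {n} → Vec (Vec Bool n) n → Fin n → Fin n → Bool
  entry t a b = lookup (lookup t a) b

  module _ {n ℓ : ℕ} (v : Vec (Fin n) ℓ) where

    Step : Fin n → Fin n → Set
    Step a b = ∃[ i ] ((lookup v i ≡ a × lookup v (next i) ≡ b) ⊎ (lookup v i ≡ b × lookup v (next i) ≡ a))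

    step? : ∀ a b → Dec (Step a b)
    step? a b = any? (λ i →
      ((lookup v i Fin.≟ a) ×-dec (lookup v (next i) Fin.≟ b)) ⊎-dec
      ((lookup v i Fin.≟ b) ×-dec (lookup v (next i) Fin.≟ a)))

    entry-edgeSet : ∀ a b → entry (edgeSet v) a b ≡ ⌊ step? a b ⌋
    entry-edgeSet a b = trans (cong (λ row → lookup row b) (lookup∘tabulate _ a)) (lookup∘tabulate _ b)

    edgeSet⁺ : ∀ {a b} → Step a b → entry (edgeSet v) a b ≡ true
    edgeSet⁺ {a} {b} st = trans (entry-edgeSet a b) (trans (isYes≗does (step? a b)) (dec-true (step? a b) st))

    edgeSet⁻ : ∀ {a b} → entry (edgeSet v) a b ≡ true → Step a b
    edgeSet⁻ {a} {b} eq with step? a b | trans (sym (entry-edgeSet a b)) eq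
    ... | yes st | _ = st

  module _ {n : ℕ} (J : Graph n) where
    open Graph J

    -- The ℓ steps of the cycle use distinct edges: equal edges with equal orientation have the same
    -- starting position, and with opposite orientation they would force `next (next j) ≡ j`.
    cycleEdges-≥ : ∀ {ℓ} (v : Vec (Fin n) ℓ) → IsCycle J v → ℓ ≤ ∣ edges (entry (edgeSet v)) ∣
    cycleEdges-≥ {ℓ} v (3≤ℓ , inj , adj) = injection⇒≤∣∣ _ (proj₁ ∘ edge) edge-injective edge-∈
      where
      edge : ∀ i → ∃[ x ] Joins x (lookup v i) (lookup v (next i))
      edge i = joining _ _ λ eq → irrefl eq (adj i)

      edge-∈ : ∀ i → proj₁ (edge i) ∈ edges (entry (edgeSet v))
      edge-∈ i with edge i
      ... | x , inj₁ eq = ∈-tabulate⁺ (trans (cong (uncurry (entry (edgeSet v))) eq)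
              (edgeSet⁺ v (i , inj₁ (refl , refl))))
      ... | x , inj₂ eq = ∈-tabulate⁺ (trans (cong (uncurry (entry (edgeSet v))) eq)
              (edgeSet⁺ v (i , inj₂ (refl , refl))))

      same : ∀ {x} i j → Joins x (lookup v i) (lookup v (next i)) →
             Joins x (lookup v j) (lookup v (next j)) → i ≡ j
      same i j (inj₁ p) (inj₁ q) = inj i j (cong proj₁ (trans (sym p) q))
      same i j (inj₂ p) (inj₂ q) = inj i j (cong proj₂ (trans (sym p) q))
      same i j (inj₁ p) (inj₂ q) = reversed i j (trans (sym p) q)
        where
        reversed : ∀ i j → (lookup v i , lookup v (next i)) ≡ (lookup v (next j) , lookup v j) → i ≡ j
        reversed i j eq with refl ← inj _ _ (cong proj₁ eq) =
          ⊥-elim (next∘next-≢ 3≤ℓ j (inj _ _ (cong proj₂ eq)))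
      same i j (inj₂ p) (inj₁ q) = reversed i j (trans (sym p) q)
        where
        reversed : ∀ i j → (lookup v (next i) , lookup v i) ≡ (lookup v j , lookup v (next j)) → i ≡ j
        reversed i j eq with refl ← inj _ _ (cong proj₂ eq) =
          ⊥-elim (next∘next-≢ 3≤ℓ j (inj _ _ (cong proj₁ eq)))

      edge-injective : Injective _≡_ _≡_ (proj₁ ∘ edge)
      edge-injective {i} {j} eq = same i j (proj₂ (edge i))
        (subst (λ x → Joins x (lookup v j) (lookup v (next j))) (sym eq) (proj₂ (edge j)))

    -- Only the deduplicated matrices are mapped, so the list has exactly `C ℓ J` entries, as the
    -- expectation bound requires.
    cyclesOfLength : ℕ → List (Subset (pairs n))
    cyclesOfLength ℓ = map (edges ∘ entry) (cycleSubgraphs ℓ J)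

    ∈-cyclesOfLength⁺ : ∀ {ℓ} (v : Vec (Fin n) ℓ) → IsCycle J v → edges (entry (edgeSet v)) ∈ₗ cyclesOfLength ℓ
    ∈-cyclesOfLength⁺ v cyc = ∈-map⁺ (edges ∘ entry) (∈-deduplicate⁺ (Vec-≡-dec (Vec-≡-dec Bool._≟_))
      (∈-map⁺ edgeSet (∈-filter⁺ (isCycle? J) (∈-vertexTuples v) cyc)))

    ∈-cyclesOfLength⁻ : ∀ {ℓ t} → t ∈ₗ cyclesOfLength ℓ → 3 ≤ ℓ × ℓ ≤ ∣ t ∣
    ∈-cyclesOfLength⁻ {ℓ} t∈
      with m , m∈ , refl ← ∈-map⁻ (edges ∘ entry) t∈
      with v , v∈ , refl ← ∈-map⁻ edgeSet (∈-deduplicate⁻ (Vec-≡-dec (Vec-≡-dec Bool._≟_)) _ m∈)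
      with _ , cyc ← ∈-filter⁻ (isCycle? J) {xs = vertexTuples n ℓ} v∈
      = proj₁ cyc , cycleEdges-≥ v cyc

    shortCycles : ℕ → List (Subset (pairs n))
    shortCycles r = concat (applyUpTo (cyclesOfLength ∘ (3 +_)) (r ∸ 3))

    shortCycles-nonempty : ∀ r {t} → t ∈ₗ shortCycles r → Nonempty t
    shortCycles-nonempty r {t} t∈ =
      let ts , t∈ts , ts∈ = ∈-concat⁻′ (applyUpTo (cyclesOfLength ∘ (3 +_)) (r ∸ 3)) t∈
          i , _ , ts≡ = ∈-applyUpTo⁻ (cyclesOfLength ∘ (3 +_)) ts∈
          _ , 3+i≤∣t∣ = ∈-cyclesOfLength⁻ {3 + i} (subst (t ∈ₗ_) ts≡ t∈ts)
      in nonempty-∣∣ t (≤-trans z<s 3+i≤∣t∣)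

    ∈-shortCycles : ∀ {r ℓ} (v : Vec (Fin n) ℓ) → IsCycle J v → ℓ < r →
                    edges (entry (edgeSet v)) ∈ₗ shortCycles r
    ∈-shortCycles {r} {ℓ} v cyc@(3≤ℓ , _) ℓ<r = ∈-concat⁺′ (∈-cyclesOfLength⁺ v cyc)
      (subst (λ k → cyclesOfLength k ∈ₗ applyUpTo (cyclesOfLength ∘ (3 +_)) (r ∸ 3)) (m+[n∸m]≡n 3≤ℓ)
        (∈-applyUpTo⁺ (cyclesOfLength ∘ (3 +_)) (∸-monoˡ-< ℓ<r 3≤ℓ)))

    -- The subgraph cut out by a set of pairs

    subgraph : Subset (pairs n) → Graph n
    subgraph s = record
      { _~_    = λ u v → u ~ v × ∃[ x ] x ∈ s × Joins x u v
      ; _~?_   = λ u v → (u ~? v) ×-dec any? λ x → (x ∈? s) ×-dec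
                   ((endpoints n x ≟-pair (u , v)) ⊎-dec (endpoints n x ≟-pair (v , u)))
      ; symm   = λ (u~v , x , x∈s , joins) → symm u~v , x , x∈s , swap⊎ joins
      ; irrefl = λ u≡v (u~v , _) → irrefl u≡v u~v
      }
      where
      _≟-pair_ = ×-≡-dec Fin._≟_ Fin._≟_

    subgraph-⊆ : ∀ s → subgraph s ⊆ᴳ J
    subgraph-⊆ s = record { embed = id ; injective = id ; edges = proj₁ }

    -- A cycle of the subgraph is a cycle of `J` with all its edges in `s`; if shorter than r, it
    -- would be one of the avoided sets.
    subgraph-girth : ∀ r {s} → (∀ {t} → t ∈ₗ shortCycles r → ¬ t ⊆ s) →
                     ∀ ℓ → HasCycle (subgraph s) ℓ → r ≤ ℓ
    subgraph-girth r {s} avoid ℓ (v , 3≤ℓ , inj , adj) = ≮⇒≥ λ ℓ<r →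
      avoid (∈-shortCycles v (3≤ℓ , inj , proj₁ ∘ adj) ℓ<r) contained-edges
      where
      joined : ∀ {x a b} → endpoints n x ≡ (a , b) → Step v a b → x ∈ s
      joined {x} {a} {b} ends (i , step) =
        let _ , y , y∈s , joins = adj i
        in subst (_∈ s) (joins-unique joins (orient step)) y∈s
        where
        orient : (lookup v i ≡ a × lookup v (next i) ≡ b) ⊎ (lookup v i ≡ b × lookup v (next i) ≡ a) →
                 Joins x (lookup v i) (lookup v (next i))
        orient (inj₁ (p , q)) = inj₁ (trans ends (cong₂ _,_ (sym p) (sym q)))
        orient (inj₂ (p , q)) = inj₂ (trans ends (cong₂ _,_ (sym q) (sym p)))
      contained-edges : edges (entry (edgeSet v)) ⊆ s
      contained-edges x∈ = joined refl (edgeSet⁻ v (∈-tabulate⁻ x∈))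

    -- A colouring with k ≤ q colours is also a q-colouring, for which `s` holds a monochromatic
    -- edge. Colourings are vectors here because these can be listed by `vertexTuples`.
    subgraph-not-colourable : ∀ {q s} →
      (∀ (c : Vec (Fin q) n) → Nonempty (s ∩ monochromaticEdges J (lookup c))) →
      ∀ k → Colourable (subgraph s) k → q < k
    subgraph-not-colourable {q} {s} meets k (c , proper) = ≰⇒> λ k≤q →
      let d  = λ v → inject≤ (c v) k≤q
          c′ = tabulate d
          x , x∈ = meets c′
          x∈s , x∈mono = x∈p∩q⁻ s (monochromaticEdges J (lookup c′)) x∈
          u~v , eq = monochromatic⁻ J (lookup c′) (∈-tabulate⁻ x∈mono)
      in proper _ _ (u~v , x , x∈s , inj₁ refl)
           (Finₚ.inject≤-injective k≤q k≤q _ _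
             (trans (sym (lookup∘tabulate d _)) (trans eq (lookup∘tabulate d _))))

    high-girth-subgraph : ∀ r q s →
      (∀ (c : Vec (Fin q) n) → Nonempty (s ∩ monochromaticEdges J (lookup c))) →
      (∀ {t} → t ∈ₗ shortCycles r → ¬ t ⊆ s) →
      ∃[ k ] Σ[ H ∈ Graph k ] H ⊆ᴳ J ×
        (∃[ g ] IsGirth H g × fin r ≤⁺ g) ×
        (∃[ χ ] IsChromaticNumber H χ × suc q ≤ χ)
    high-girth-subgraph r q s meets avoid =
      let χ , isχ = chromaticNumber (subgraph s)
      in n , subgraph s , subgraph-⊆ s , girth-≥ (subgraph s) r (subgraph-girth r avoid) ,
         χ , isχ , subgraph-not-colourable meets χ (proj₁ isχ)

  -- The probabilistic estimate

  -- With p = a / (a + a′) this is (1 - p/2)^∣m∣ ≤ 2^(-k) for k ≤ p∣m∣/2, scaled; it is `decay` for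
  -- the fraction a / 2(a + a′).
  weight-decay : ∀ a a′ k {e} (m : Subset e) → .{{_ : NonZero (a + a′)}} →
    2 * (a + a′) * k ≤ a * ∣ m ∣ → weight (a + 2 * a′) (2 * (a + a′)) m * 2 ^ k ≤ (2 * (a + a′)) ^ e
  weight-decay a a′ k {e} m bk≤am = *-cancelʳ-≤ _ _ (b ^ ∣ m ∣) {{m^n≢0 b ∣ m ∣}} (begin
    weight x b m * 2 ^ k * b ^ ∣ m ∣      ≡⟨ exchange (weight x b m) (2 ^ k) (b ^ ∣ m ∣) ⟩
    weight x b m * b ^ ∣ m ∣ * 2 ^ k      ≡⟨ cong (_* 2 ^ k) (weight-∣∣ x b m) ⟩
    x ^ ∣ m ∣ * b ^ e * 2 ^ k             ≡⟨ exchange (x ^ ∣ m ∣) (b ^ e) (2 ^ k) ⟩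
    x ^ ∣ m ∣ * 2 ^ k * b ^ e
      ≤⟨ *-monoˡ-≤ (b ^ e) (decay x a ∣ m ∣ k (x+a≡b a a′) bk≤am) ⟩
    b ^ ∣ m ∣ * b ^ e                     ≡⟨ *-comm (b ^ ∣ m ∣) _ ⟩
    b ^ e * b ^ ∣ m ∣                     ∎)
    where
    open ≤-Reasoning
    x = a + 2 * a′
    b = 2 * (a + a′)
    instance
      b≢0 : NonZero b
      b≢0 = m*n≢0 2 (a + a′)
    x+a≡b : ∀ a a′ → a + 2 * a′ + a ≡ 2 * (a + a′)
    x+a≡b = solve-∀
    exchange : ∀ u v w → u * v * w ≡ u * w * v
    exchange = solve-∀

  -- With p = a / (a + a′) and M = d² / 2q, the quantities A and B have A / B = pM.
  module _ {n : ℕ} (J : Graph n) (r q d a a′ L : ℕ) .{{_ : NonZero q}} .{{b≢0 : NonZero (a + a′)}} where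

    private
      b = a + a′
      A = a * sq d
      B = b * (2 * q)

    -- Divided by B, the numerical hypotheses read 4nL + 16 ≤ pM + 2 and 16 · (expected number of
    -- kept short cycles) ≤ pM + 2. The summand 2 leaves room for the errors of approximating the
    -- reals.
    dense-sparse : (∀ k → Colourable J k → q + d ≤ k) → q ≤ 2 ^ L →
      (4 * (n * L) + 16) * B ≤ A + 2 * B →
      16 * sum (map (weight a b) (shortCycles J r)) * B ≤ (A + 2 * B) * b ^ pairs n →
      ∃[ k ] Σ[ H ∈ Graph k ] H ⊆ᴳ J ×
        (∃[ g ] IsGirth H g × fin r ≤⁺ g) ×
        (∃[ χ ] IsChromaticNumber H χ × suc q ≤ χ)
    dense-sparse minimal q≤2^L dense sparse =
      let s , meets , avoid = transversal a a′ K ms ts (shortCycles-nonempty J r) small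
      in high-girth-subgraph J r q s (λ c → meets (∈-map⁺ mono (∈-vertexTuples c))) avoid
      where
      open ≤-Reasoning
      instance
        2q≢0 : NonZero (2 * q)
        2q≢0 = m*n≢0 2 q
        B≢0 : NonZero B
        B≢0 = m*n≢0 b (2 * q)
        8B≢0 : NonZero (8 * B)
        8B≢0 = m*n≢0 8 B
      mono = λ c → monochromaticEdges J (lookup c)
      ms = map mono (vertexTuples q n)
      ts = shortCycles J r
      e = pairs n
      -- ⌊pM/8⌋ + 1, which is positive and lies between pM/8 and pM/8 + 1.
      K = suc (A / (8 * B))
      -- The decay 2^(-S) must outweigh at most 2^(nL) colourings and the factor 2^K, and still
      -- leave 1/4.
      S = n * L + K + 2
      X = sum (map (weight (a + 2 * a′) (2 * b)) ms)
      W = sum (map (weight a b) ts)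

      A≤8BK : A ≤ 8 * B * K
      A≤8BK = begin
        A                                     ≡⟨ m≡m%n+[m/n]*n A (8 * B) ⟩
        A % (8 * B) + A / (8 * B) * (8 * B)   ≤⟨ +-monoˡ-≤ _ (<⇒≤ (m%n<n A (8 * B))) ⟩
        K * (8 * B)                           ≡⟨ *-comm K (8 * B) ⟩
        8 * B * K                             ∎

      8BK≤A+8B : 8 * B * K ≤ A + 8 * B
      8BK≤A+8B = begin
        8 * B * K                             ≡⟨ *-comm (8 * B) K ⟩
        8 * B + A / (8 * B) * (8 * B)         ≤⟨ +-monoʳ-≤ (8 * B) (m/n*n≤m A (8 * B)) ⟩
        8 * B + A                             ≡⟨ +-comm (8 * B) A ⟩
        A + 8 * B                             ∎

      2BS≤A : 2 * B * S ≤ A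
      -- From nL ≤ pM/4 - 7/2 and K ≤ pM/8 + 1 follows S ≤ 3pM/8 - 1/2 ≤ pM/2.
      2BS≤A = *-cancelˡ-≤ 4 (+-cancelʳ-≤ (32 * B) _ _ (begin
        4 * (2 * B * S) + 32 * B                                       ≡⟨ expand (n * L) B K ⟩
        2 * ((4 * (n * L) + 16) * B) + 8 * B * K + 16 * B
          ≤⟨ +-monoˡ-≤ (16 * B) (+-mono-≤ (*-monoʳ-≤ 2 dense) 8BK≤A+8B) ⟩
        2 * (A + 2 * B) + (A + 8 * B) + 16 * B                         ≤⟨ m≤m+n _ (A + 4 * B) ⟩
        2 * (A + 2 * B) + (A + 8 * B) + 16 * B + (A + 4 * B)           ≡⟨ collect A B ⟩
        4 * A + 32 * B                                                 ∎))
        where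
        expand : ∀ nL B K → 4 * (2 * B * (nL + K + 2)) + 32 * B
                          ≡ 2 * ((4 * nL + 16) * B) + 8 * B * K + 16 * B
        expand = solve-∀
        collect : ∀ A B → 2 * (A + 2 * B) + (A + 8 * B) + 16 * B + (A + 4 * B) ≡ 4 * A + 32 * B
        collect = solve-∀

      exponent : ∀ {m} → m ∈ₗ ms → 2 * b * S ≤ a * ∣ m ∣
      exponent m∈ms with c , _ , refl ← ∈-map⁻ mono m∈ms = *-cancelˡ-≤ (2 * q) (begin
        2 * q * (2 * b * S)                 ≡⟨ regroup q b S ⟩
        2 * B * S                           ≤⟨ 2BS≤A ⟩
        a * sq d
          ≤⟨ *-monoʳ-≤ a (∣monochromaticEdges∣-≥ J minimal (lookup c)) ⟩
        a * (2 * q * ∣ mono c ∣)            ≡⟨ swap a (2 * q) ∣ mono c ∣ ⟩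
        2 * q * (a * ∣ mono c ∣)            ∎)
        where
        regroup : ∀ q b S → 2 * q * (2 * b * S) ≡ 2 * (b * (2 * q)) * S
        regroup = solve-∀
        swap : ∀ x y z → x * (y * z) ≡ y * (x * z)
        swap = solve-∀

      colourings : length ms ≤ 2 ^ (n * L)
      colourings = begin
        length ms         ≡⟨ trans (length-map mono (vertexTuples q n)) (length-vertexTuples q n) ⟩
        q ^ n             ≤⟨ ^-monoˡ-≤ n q≤2^L ⟩
        (2 ^ L) ^ n       ≡⟨ trans (^-*-assoc 2 L n) (cong (2 ^_) (*-comm L n)) ⟩
        2 ^ (n * L)       ∎

      X-small : 2 ^ K * X * 4 ≤ (2 * b) ^ e
      X-small = *-cancelˡ-≤ (2 ^ (n * L)) {{m^n≢0 2 (n * L)}} (begin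
        2 ^ (n * L) * (2 ^ K * X * 4)       ≡⟨ regroup (2 ^ (n * L)) (2 ^ K) X ⟩
        X * (2 ^ (n * L) * 2 ^ K * 2 ^ 2)
          ≡⟨ cong (X *_) (trans (^-distribˡ-+-* 2 (n * L + K) 2) (cong (_* 4) (^-distribˡ-+-* 2 (n * L) K))) ⟨
        X * 2 ^ S
          ≤⟨ sum-map-≤ (weight (a + 2 * a′) (2 * b)) (2 ^ S) ((2 * b) ^ e) ms
               (λ {m} m∈ → weight-decay a a′ S m (exponent m∈)) ⟩
        length ms * (2 * b) ^ e             ≤⟨ *-monoˡ-≤ ((2 * b) ^ e) colourings ⟩
        2 ^ (n * L) * (2 * b) ^ e           ∎)
        where
        regroup : ∀ u v x → u * (v * x * 4) ≡ x * (u * v * 4)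
        regroup = solve-∀

      W-small : 8 * W ≤ 5 * (K * b ^ e)
      -- Since pM ≤ 8K and 1 ≤ K, the expectation is at most (8K + 2K)/16 = 5K/8.
      W-small = *-cancelˡ-≤ (2 * B) {{m*n≢0 2 B}} (begin
        2 * B * (8 * W)                            ≡⟨ regroup B W ⟩
        16 * W * B                                 ≤⟨ sparse ⟩
        (A + 2 * B) * b ^ e
          ≤⟨ *-monoˡ-≤ (b ^ e) (+-mono-≤ A≤8BK (*-monoʳ-≤ 2 (m≤m*n B K))) ⟩
        (8 * B * K + 2 * (B * K)) * b ^ e          ≡⟨ collect B K (b ^ e) ⟩
        2 * B * (5 * (K * b ^ e))                  ∎)
        where
        regroup : ∀ B W → 2 * B * (8 * W) ≡ 16 * W * B
        regroup = solve-∀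
        collect : ∀ B K y → (8 * B * K + 2 * (B * K)) * y ≡ 2 * B * (5 * (K * y))
        collect = solve-∀

      T = K * 2 ^ e * b ^ e

      0<T : 0 < T
      0<T = >-nonZero⁻¹ T {{m*n≢0 (K * 2 ^ e) (b ^ e) {{m*n≢0 K (2 ^ e) {{_}} {{m^n≢0 2 e}}}} {{m^n≢0 b e}}}}

      small : K * 2 ^ K * X + 2 ^ e * W < T
      -- In units of T the two terms are at most 1/4 and 5/8, together 7/8.
      small = *-cancelˡ-< 8 _ _ (begin-strict
        8 * (K * 2 ^ K * X + 2 ^ e * W)                      ≡⟨ regroup K (2 ^ K) X (2 ^ e) W ⟩
        2 * K * (2 ^ K * X * 4) + 2 ^ e * (8 * W)
          ≤⟨ +-mono-≤ (*-monoʳ-≤ (2 * K) X-small) (*-monoʳ-≤ (2 ^ e) W-small) ⟩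
        2 * K * (2 * b) ^ e + 2 ^ e * (5 * (K * b ^ e))
          ≡⟨ cong (λ y → 2 * K * y + 2 ^ e * (5 * (K * b ^ e))) (^-distribʳ-* e 2 b) ⟩
        2 * K * (2 ^ e * b ^ e) + 2 ^ e * (5 * (K * b ^ e))  ≡⟨ collect K (2 ^ e) (b ^ e) ⟩
        7 * T
          <⟨ *-monoˡ-< T {{>-nonZero 0<T}} {7} {8} ≤-refl ⟩
        8 * T                                                ∎)
        where
        regroup : ∀ K u X v W → 8 * (K * u * X + v * W) ≡ 2 * K * (u * X * 4) + v * (8 * W)
        regroup = solve-∀
        collect : ∀ K u v → 2 * K * (u * v) + u * (5 * (K * v)) ≡ 7 * (K * u * v)
        collect = solve-∀

module _ where
  open import Data.Integer as ℤ using (+_; -[1+_])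
  import Data.Integer.Properties as ℤ
  open import Data.List.Properties using (length-map)
  open import Data.Nat as ℕ using (ℕ; zero; suc; NonZero)
  import Data.Nat.Properties as ℕ
  import Data.Nat.Tactic.RingSolver as ℕ
  open import Data.Rational as ℚ
    using (ℚ; mkℚ; 0ℚ; 1ℚ; _+_; _*_; _≤_; _<_; _/_; 1/_; Positive; NonNegative)
  import Data.Rational.Properties as ℚ
  open import Data.Rational.Solver using (module +-*-Solver)
  open import Data.Rational.Unnormalised as ℚᵘ using (mkℚᵘ)
  import Data.Rational.Unnormalised.Properties as ℚᵘ

  -- Natural numbers inside ℚ

  ι : ℕ → ℚ
  ι n = + n / 1

  toℚᵘ-/ : ∀ z k .{{_ : NonZero k}} → ℚ.toℚᵘ (z / k) ℚᵘ.≃ (z ℚᵘ./ k)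
  toℚᵘ-/ z (suc k) = ℚ.toℚᵘ-fromℚᵘ (mkℚᵘ z k)

  ι-+ : ∀ m n → ι (m ℕ.+ n) ≡ ι m + ι n
  ι-+ m n = ℚ.toℚᵘ-injective (begin
    ℚ.toℚᵘ (ι (m ℕ.+ n))                  ≈⟨ toℚᵘ-/ (+ (m ℕ.+ n)) 1 ⟩
    mkℚᵘ (+ (m ℕ.+ n)) 0
      ≈⟨ ℚᵘ.*≡* (cong (ℤ._* + 1) (cong₂ ℤ._+_ (sym (ℤ.*-identityʳ (+ m))) (sym (ℤ.*-identityʳ (+ n))))) ⟩
    mkℚᵘ (+ m) 0 ℚᵘ.+ mkℚᵘ (+ n) 0        ≈⟨ ℚᵘ.+-cong (toℚᵘ-/ (+ m) 1) (toℚᵘ-/ (+ n) 1) ⟨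
    ℚ.toℚᵘ (ι m) ℚᵘ.+ ℚ.toℚᵘ (ι n)        ≈⟨ ℚ.toℚᵘ-homo-+ (ι m) (ι n) ⟨
    ℚ.toℚᵘ (ι m + ι n)                    ∎)
    where open ℚᵘ.≃-Reasoning

  /-*-cancel : ∀ z k .{{_ : NonZero k}} n → (z / k) * ι (k ℕ.* n) ≡ (z ℤ.* + n) / 1
  /-*-cancel z k@(suc k′) n = ℚ.toℚᵘ-injective (begin
    ℚ.toℚᵘ ((z / k) * ι (k ℕ.* n))                    ≈⟨ ℚ.toℚᵘ-homo-* (z / k) (ι (k ℕ.* n)) ⟩
    ℚ.toℚᵘ (z / k) ℚᵘ.* ℚ.toℚᵘ (ι (k ℕ.* n))
      ≈⟨ ℚᵘ.*-cong (toℚᵘ-/ z k) (toℚᵘ-/ (+ (k ℕ.* n)) 1) ⟩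
    mkℚᵘ z k′ ℚᵘ.* mkℚᵘ (+ (k ℕ.* n)) 0               ≈⟨ ℚᵘ.*≡* eq ⟩
    mkℚᵘ (z ℤ.* + n) 0                                ≈⟨ toℚᵘ-/ (z ℤ.* + n) 1 ⟨
    ℚ.toℚᵘ ((z ℤ.* + n) / 1)                          ∎)
    where
    open ℚᵘ.≃-Reasoning
    eq : z ℤ.* + (k ℕ.* n) ℤ.* + 1 ≡ z ℤ.* + n ℤ.* + (k ℕ.* 1)
    eq = trans (ℤ.*-identityʳ _) (trans (cong (z ℤ.*_) (trans (ℤ.pos-* k n) (ℤ.*-comm (+ k) (+ n))))
      (trans (sym (ℤ.*-assoc z (+ n) (+ k))) (cong (λ t → z ℤ.* + n ℤ.* + t) (sym (ℕ.*-identityʳ k)))))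

  ι-* : ∀ m n → ι (m ℕ.* n) ≡ ι m * ι n
  ι-* m n = trans (cong (_/ 1) (ℤ.pos-* m n))
    (trans (sym (/-*-cancel (+ m) 1 n)) (cong (λ t → ι m * ι t) (ℕ.*-identityˡ n)))

  ι-mono-≤ : ∀ {m n} → m ℕ.≤ n → ι m ≤ ι n
  ι-mono-≤ {m} {n} m≤n = ℚ.toℚᵘ-cancel-≤
    (ℚᵘ.≤-respˡ-≃ (ℚᵘ.≃-sym (toℚᵘ-/ (+ m) 1)) (ℚᵘ.≤-respʳ-≃ (ℚᵘ.≃-sym (toℚᵘ-/ (+ n) 1))
      (ℚᵘ.*≤* (ℤ.*-monoʳ-≤-nonNeg (+ 1) (ℤ.+≤+ m≤n)))))

  ι-cancel-≤ : ∀ {m n} → ι m ≤ ι n → m ℕ.≤ n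
  ι-cancel-≤ {m} {n} p with ℚᵘ.≤-respˡ-≃ (toℚᵘ-/ (+ m) 1) (ℚᵘ.≤-respʳ-≃ (toℚᵘ-/ (+ n) 1) (ℚ.toℚᵘ-mono-≤ p))
  ... | ℚᵘ.*≤* q = ℤ.drop‿+≤+ (ℤ.*-cancelʳ-≤-pos (+ m) (+ n) (+ 1) q)

  ι-nonNeg : ∀ n → NonNegative (ι n)
  ι-nonNeg n = ℚ.normalize-nonNeg n 1

  ι-pos : ∀ n .{{_ : NonZero n}} → Positive (ι n)
  ι-pos n = ℚ.normalize-pos n 1

  *-mono-≤ : ∀ {p q r s} → 0ℚ ≤ q → 0ℚ ≤ r → p ≤ q → r ≤ s → p * r ≤ q * s
  *-mono-≤ {p} {q} {r} {s} 0≤q 0≤r p≤q r≤s = ℚ.≤-trans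
    (ℚ.*-monoʳ-≤-nonNeg r {{ℚ.nonNegative 0≤r}} p≤q)
    (ℚ.*-monoˡ-≤-nonNeg q {{ℚ.nonNegative 0≤q}} r≤s)

  0≤* : ∀ {p q} → 0ℚ ≤ p → 0ℚ ≤ q → 0ℚ ≤ p * q
  0≤* {p} {q} 0≤p 0≤q = subst (_≤ p * q) (ℚ.*-zeroʳ p) (ℚ.*-monoˡ-≤-nonNeg p {{ℚ.nonNegative 0≤p}} 0≤q)

  0≤ι : ∀ n → 0ℚ ≤ ι n
  0≤ι n = ℚ.nonNegative⁻¹ (ι n) {{ι-nonNeg n}}

  -- Lower bounds for the logarithm

  reciprocals-+ : ∀ a k l → reciprocals a (k ℕ.+ l) ≡ reciprocals a k + reciprocals (a ℕ.+ k) l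
  reciprocals-+ a k zero    = trans (cong (reciprocals a) (ℕ.+-identityʳ k)) (sym (ℚ.+-identityʳ _))
  reciprocals-+ a k (suc l) = trans (cong (reciprocals a) (ℕ.+-suc k l))
    (trans (cong₂ _+_ (reciprocals-+ a k l) (cong (λ t → + 1 / suc t) (sym (ℕ.+-assoc a k l))))
           (ℚ.+-assoc (reciprocals a k) _ _))

  reciprocals-≥ : ∀ a l {c} → a ℕ.+ l ℕ.≤ c → ι l ≤ reciprocals a l * ι c
  reciprocals-≥ a zero    {c} _     = ℚ.≤-reflexive (sym (ℚ.*-zeroˡ (ι c)))
  reciprocals-≥ a (suc l) {c} a+l<c = begin
    ι (suc l)                                             ≡⟨ cong ι (ℕ.+-comm 1 l) ⟩
    ι (l ℕ.+ 1)                                           ≡⟨ ι-+ l 1 ⟩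
    ι l + 1ℚ
      ≤⟨ ℚ.+-mono-≤ (reciprocals-≥ a l (ℕ.≤-trans (ℕ.+-monoʳ-≤ a (ℕ.n≤1+n l)) a+l<c)) last ⟩
    reciprocals a l * ι c + (+ 1 / suc (a ℕ.+ l)) * ι c
      ≡⟨ ℚ.*-distribʳ-+ (ι c) (reciprocals a l) _ ⟨
    reciprocals a (suc l) * ι c                           ∎
    where
    open ℚ.≤-Reasoning
    t = suc (a ℕ.+ l)
    last : 1ℚ ≤ (+ 1 / t) * ι c
    last = begin
      1ℚ                       ≡⟨ /-*-cancel (+ 1) t 1 ⟨
      (+ 1 / t) * ι (t ℕ.* 1)  ≡⟨ cong (λ z → (+ 1 / t) * ι z) (ℕ.*-identityʳ t) ⟩
      (+ 1 / t) * ι t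
        ≤⟨ ℚ.*-monoˡ-≤-nonNeg (+ 1 / t) {{ℚ.normalize-nonNeg 1 t}}
             (ι-mono-≤ (subst (ℕ._≤ c) (ℕ.+-suc a l) a+l<c)) ⟩
      (+ 1 / t) * ι c          ∎

  0≤reciprocals : ∀ a l → 0ℚ ≤ reciprocals a l
  0≤reciprocals a zero    = ℚ.≤-refl
  0≤reciprocals a (suc l) = ℚ.+-mono-≤ (0≤reciprocals a l)
    (ℚ.nonNegative⁻¹ (+ 1 / suc (a ℕ.+ l)) {{ℚ.normalize-nonNeg 1 (suc (a ℕ.+ l))}})

  reciprocals-monoʳ : ∀ a {k l} → k ℕ.≤ l → reciprocals a k ≤ reciprocals a l
  reciprocals-monoʳ a {k} {l} k≤l = begin
    reciprocals a k                                          ≡⟨ ℚ.+-identityʳ _ ⟨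
    reciprocals a k + 0ℚ
      ≤⟨ ℚ.+-monoʳ-≤ (reciprocals a k) (0≤reciprocals (a ℕ.+ k) (l ℕ.∸ k)) ⟩
    reciprocals a k + reciprocals (a ℕ.+ k) (l ℕ.∸ k)        ≡⟨ reciprocals-+ a k (l ℕ.∸ k) ⟨
    reciprocals a (k ℕ.+ (l ℕ.∸ k))
      ≡⟨ cong (reciprocals a) (ℕ.m+[n∸m]≡n k≤l) ⟩
    reciprocals a l                                          ∎
    where open ℚ.≤-Reasoning

  -- The a terms 1/(a+1), ..., 1/(2a) are each at least 1/(2a): the Riemann-sum form of log 2 ≥ 1/2.
  reciprocals-doubling : ∀ a .{{_ : NonZero a}} → 1ℚ ≤ ι 2 * reciprocals a a
  reciprocals-doubling a = ℚ.*-cancelʳ-≤-pos (ι a) {{ι-pos a}} (begin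
    1ℚ * ι a                        ≡⟨ ℚ.*-identityˡ (ι a) ⟩
    ι a
      ≤⟨ reciprocals-≥ a a {2 ℕ.* a} (ℕ.≤-reflexive (cong (a ℕ.+_) (sym (ℕ.+-identityʳ a)))) ⟩
    reciprocals a a * ι (2 ℕ.* a)   ≡⟨ cong (reciprocals a a *_) (ι-* 2 a) ⟩
    reciprocals a a * (ι 2 * ι a)   ≡⟨ regroup (reciprocals a a) (ι 2) (ι a) ⟩
    ι 2 * reciprocals a a * ι a     ∎)
    where
    open ℚ.≤-Reasoning
    regroup : ∀ x y z → x * (y * z) ≡ y * x * z
    regroup = solve 3 (λ x y z → x :* (y :* z) := y :* x :* z) refl
      where open +-*-Solver

  -- The sum splits into k dyadic blocks, from 2^j N to 2^(j+1) N, each at least 1/2. Hence log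
  -- (2^k) ≥ k/2, already at every mesh.
  riemannSum-2^ : ∀ k N .{{_ : NonZero N}} → ι k ≤ ι 2 * riemannSum (2 ℕ.^ k) N
  riemannSum-2^ zero    N = ℚ.≤-refl
  riemannSum-2^ (suc k) N = begin
    ι (suc k)
      ≡⟨ trans (cong ι (ℕ.+-comm 1 k)) (ι-+ k 1) ⟩
    ι k + 1ℚ
      ≤⟨ ℚ.+-mono-≤ (riemannSum-2^ k N) (reciprocals-doubling c {{ℕ.m*n≢0 (2 ℕ.^ k) N {{ℕ.m^n≢0 2 k}}}}) ⟩
    ι 2 * reciprocals N t + ι 2 * reciprocals c c
      ≡⟨ ℚ.*-distribˡ-+ (ι 2) (reciprocals N t) (reciprocals c c) ⟨
    ι 2 * (reciprocals N t + reciprocals c c)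
      ≡⟨ cong (λ z → ι 2 * (reciprocals N t + reciprocals z c)) N+t≡c ⟨
    ι 2 * (reciprocals N t + reciprocals (N ℕ.+ t) c)    ≡⟨ cong (ι 2 *_) (reciprocals-+ N t c) ⟨
    ι 2 * reciprocals N (t ℕ.+ c)
      ≡⟨ cong (λ z → ι 2 * reciprocals N z) t+c≡ ⟩
    ι 2 * riemannSum (2 ℕ.^ suc k) N                     ∎
    where
    open ℚ.≤-Reasoning
    y = 2 ℕ.^ k
    t = (y ℕ.∸ 1) ℕ.* N
    c = y ℕ.* N
    1+[y-1]≡y : suc (y ℕ.∸ 1) ≡ y
    1+[y-1]≡y = ℕ.m+[n∸m]≡n (ℕ.m^n>0 2 k)
    N+t≡c : N ℕ.+ t ≡ c
    N+t≡c = cong (ℕ._* N) 1+[y-1]≡y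
    t+c≡ : t ℕ.+ c ≡ (2 ℕ.* y ℕ.∸ 1) ℕ.* N
    t+c≡ = trans (sym (ℕ.*-distribʳ-+ N (y ℕ.∸ 1) y)) (cong (ℕ._* N)
      (trans (cong (ℕ._∸ 1) (cong (ℕ._+ y) 1+[y-1]≡y)) (cong (λ z → (y ℕ.+ z) ℕ.∸ 1) (sym (ℕ.+-identityʳ y)))))

  riemannSum-monoˡ : ∀ {k q} N → k ℕ.≤ q → riemannSum k N ≤ riemannSum q N
  riemannSum-monoˡ N k≤q = reciprocals-monoʳ N (ℕ.*-monoˡ-≤ N (ℕ.∸-monoˡ-≤ 1 k≤q))

  n<2^n : ∀ n → n ℕ.< 2 ℕ.^ n
  n<2^n zero    = ℕ.s≤s ℕ.z≤n
  n<2^n (suc n) = ℕ.≤-trans (ℕ.+-mono-≤ (ℕ.m^n>0 2 n) (n<2^n n))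
    (ℕ.≤-reflexive (cong (2 ℕ.^ n ℕ.+_) (sym (ℕ.+-identityʳ _))))

  -- L = ⌈log₂ q⌉, which is at most 2 ⌊log₂ q⌋ when q ≥ 2.
  binary-bounds : ∀ q .{{_ : NonZero q}} → ∃[ j ] ∃[ L ] 2 ℕ.^ j ℕ.≤ q × q ℕ.≤ 2 ℕ.^ L × L ℕ.≤ 2 ℕ.* j
  binary-bounds q with least (λ k → q ℕ.≤? 2 ℕ.^ k) {q} (ℕ.<⇒≤ (n<2^n q))
  ... | zero        , q≤ , _       = 0 , 0 , ℕ.>-nonZero⁻¹ q , q≤ , ℕ.z≤n
  -- Here L - 1 = 0 would be too small for j, but q > 1 allows j = 1. In the last case j = L - 1
  -- works, because 2^(L-1) < q and L ≥ 2.
  ... | suc zero    , q≤ , minimal = 1 , 1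
    , ℕ.≰⇒> (λ q≤1 → ℕ.<⇒≱ (ℕ.s≤s ℕ.z≤n) (minimal 0 q≤1)) , q≤ , ℕ.s≤s ℕ.z≤n
  ... | suc (suc k) , q≤ , minimal = suc k , suc (suc k)
    , ℕ.<⇒≤ (ℕ.≰⇒> (λ q≤2^k → ℕ.<⇒≱ ℕ.≤-refl (minimal (suc k) q≤2^k))) , q≤
    , ℕ.≤-trans (ℕ.m≤m+n (suc (suc k)) k) (ℕ.≤-reflexive (double k))
    where
    double : ∀ k → suc (suc k) ℕ.+ k ≡ 2 ℕ.* suc k
    double = ℕ.solve-∀

  -- This is log q ≥ j/2 ≥ L/4 with one L for all meshes, so L does not depend on where the real
  -- sequences are evaluated.
  riemannSum-≥ : ∀ q .{{_ : NonZero q}} → ∃[ L ] q ℕ.≤ 2 ℕ.^ L ×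
    (∀ N .{{_ : NonZero N}} → ι L ≤ ι 4 * riemannSum q N)
  riemannSum-≥ q with j , L , 2^j≤q , q≤2^L , L≤2j ← binary-bounds q = L , q≤2^L , λ N → begin
    ι L                                   ≤⟨ ι-mono-≤ L≤2j ⟩
    ι (2 ℕ.* j)                           ≡⟨ ι-* 2 j ⟩
    ι 2 * ι j                             ≤⟨ *-mono-≤ (0≤ι 2) (0≤ι j) ℚ.≤-refl (riemannSum-2^ j N) ⟩
    ι 2 * (ι 2 * riemannSum (2 ℕ.^ j) N)  ≡⟨ ℚ.*-assoc (ι 2) (ι 2) (riemannSum (2 ℕ.^ j) N) ⟨
    ι 4 * riemannSum (2 ℕ.^ j) N
      ≤⟨ *-mono-≤ (0≤ι 4) (0≤reciprocals N ((2 ℕ.^ j ℕ.∸ 1) ℕ.* N)) ℚ.≤-refl (riemannSum-monoˡ N 2^j≤q) ⟩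
    ι 4 * riemannSum q N                  ∎
    where open ℚ.≤-Reasoning

  -- Rational approximation of the probability

  M-* : ∀ q d .{{_ : NonZero q}} → M (q ℕ.+ d) q * ι (2 ℕ.* q) ≡ ι (d ℕ.* d)
  M-* q d = trans (cong (M (q ℕ.+ d) q *_) (cong ι (sym (ℕ.*-identityʳ (2 ℕ.* q)))))
    (trans (/-*-cancel ((+ (q ℕ.+ d) ℤ.- + q) ℤ.^ 2) (2 ℕ.* q) {{ℕ.m*n≢0 2 q}} 1) (cong (_/ 1) square))
    where
    difference : + (q ℕ.+ d) ℤ.- + q ≡ + d
    difference = trans (ℤ.m-n≡m⊖n (q ℕ.+ d) q) (trans (ℤ.⊖-≥ (ℕ.m≤m+n q d)) (cong +_ (ℕ.m+n∸m≡n q d)))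
    square : (+ (q ℕ.+ d) ℤ.- + q) ℤ.^ 2 ℤ.* + 1 ≡ + (d ℕ.* d)
    square = trans (ℤ.*-identityʳ _) (trans (cong (ℤ._^ 2) difference)
      (trans (cong (+ d ℤ.*_) (ℤ.*-identityʳ (+ d))) (sym (ℤ.pos-* d d))))

  -- A term of the sequence of a real at most 1 may exceed 1 by the tolerance ε. Replacing it by its
  -- minimum with 1 costs at most εM = 1 in pM.
  truncate : ∀ p ε M → 0ℚ ≤ M → ε * M ≡ 1ℚ → 0ℚ < p → p ≤ 1ℚ + ε →
             ∃[ p′ ] 0ℚ < p′ × p′ ≤ 1ℚ × p′ ≤ p × p * M ≤ p′ * M + 1ℚ
  truncate p ε M 0≤M εM≡1 0<p p≤1+ε with ℚ.≤-total p 1ℚ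
  ... | inj₁ p≤1 = p , 0<p , p≤1 , ℚ.≤-refl , (begin
    p * M           ≡⟨ ℚ.+-identityʳ _ ⟨
    p * M + 0ℚ      ≤⟨ ℚ.+-monoʳ-≤ (p * M) (0≤ι 1) ⟩
    p * M + 1ℚ      ∎)
    where open ℚ.≤-Reasoning
  ... | inj₂ 1≤p = 1ℚ , ℚ.positive⁻¹ 1ℚ , ℚ.≤-refl , 1≤p , (begin
    p * M           ≤⟨ ℚ.*-monoʳ-≤-nonNeg M {{ℚ.nonNegative 0≤M}} p≤1+ε ⟩
    (1ℚ + ε) * M    ≡⟨ ℚ.*-distribʳ-+ M 1ℚ ε ⟩
    1ℚ * M + ε * M  ≡⟨ cong (λ t → 1ℚ * M + t) εM≡1 ⟩
    1ℚ * M + 1ℚ     ∎)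
    where open ℚ.≤-Reasoning

  fraction : ∀ p → 0ℚ < p → p ≤ 1ℚ → ∃[ a ] ∃[ a′ ] NonZero (a ℕ.+ a′) × p * ι (a ℕ.+ a′) ≡ ι a
  fraction (mkℚ -[1+ _ ] _ _) (ℚ.*<* ()) _
  fraction p@(mkℚ (+ a) k _) _ (ℚ.*≤* a≤k) = a , suc k ℕ.∸ a , subst NonZero (sym a+a′≡k) _ , (begin
    p * ι (a ℕ.+ (suc k ℕ.∸ a))     ≡⟨ cong (λ t → p * ι t) a+a′≡k ⟩
    p * ι (suc k)
      ≡⟨ cong₂ _*_ (sym (ℚ.↥p/↧p≡p p)) (cong ι (sym (ℕ.*-identityʳ (suc k)))) ⟩
    (+ a / suc k) * ι (suc k ℕ.* 1) ≡⟨ /-*-cancel (+ a) (suc k) 1 ⟩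
    (+ a ℤ.* + 1) / 1               ≡⟨ cong (_/ 1) (ℤ.*-identityʳ (+ a)) ⟩
    ι a                             ∎)
    where
    open ≡-Reasoning
    a+a′≡k : a ℕ.+ (suc k ℕ.∸ a) ≡ suc k
    a+a′≡k = ℕ.m+[n∸m]≡n (ℤ.drop‿+≤+ (subst₂ ℤ._≤_ (ℤ.*-identityʳ (+ a)) (ℤ.*-identityˡ (+ suc k)) a≤k))

  -- Expected number of short cycles

  ι-sumᵣ-≤ : ∀ i D (f : ℕ → ℝ) (g : ℕ → ℕ) k → (∀ j → ι (g j) ≤ D * seq (f j) i) →
             ι (sum (applyUpTo g k)) ≤ D * seq (sumᵣ (applyUpTo f k)) i
  ι-sumᵣ-≤ i D f g zero    bound = ℚ.≤-reflexive (sym (ℚ.*-zeroʳ D))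
  ι-sumᵣ-≤ i D f g (suc k) bound = begin
    ι (g 0 ℕ.+ sum (applyUpTo (g ∘ suc) k))                              ≡⟨ ι-+ (g 0) _ ⟩
    ι (g 0) + ι (sum (applyUpTo (g ∘ suc) k))
      ≤⟨ ℚ.+-mono-≤ (bound 0) (ι-sumᵣ-≤ i D (f ∘ suc) (g ∘ suc) k (bound ∘ suc)) ⟩
    D * seq (f 0) i + D * seq (sumᵣ (applyUpTo (f ∘ suc) k)) i           ≡⟨ ℚ.*-distribˡ-+ D _ _ ⟨
    D * seq (sumᵣ (applyUpTo f (suc k))) i                               ∎
    where open ℚ.≤-Reasoning

  module _ (p : ℝ) (i a b : ℕ) .{{_ : NonZero b}} (0≤p : 0ℚ ≤ seq p i) (a≤pb : ι a ≤ seq p i * ι b) where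

    0≤^ᵣ : ∀ ℓ → 0ℚ ≤ seq (p ^ᵣ ℓ) i
    0≤^ᵣ zero    = 0≤ι 1
    0≤^ᵣ (suc ℓ) = 0≤* 0≤p (0≤^ᵣ ℓ)

    ι-^-≤ : ∀ ℓ → ι (a ℕ.^ ℓ) ≤ seq (p ^ᵣ ℓ) i * ι (b ℕ.^ ℓ)
    ι-^-≤ zero    = ℚ.≤-refl
    ι-^-≤ (suc ℓ) = begin
      ι (a ℕ.* a ℕ.^ ℓ)                              ≡⟨ ι-* a _ ⟩
      ι a * ι (a ℕ.^ ℓ)
        ≤⟨ *-mono-≤ (0≤* 0≤p (0≤ι b)) (0≤ι (a ℕ.^ ℓ)) a≤pb (ι-^-≤ ℓ) ⟩
      x * ι b * (y * ι (b ℕ.^ ℓ))                    ≡⟨ regroup x (ι b) y _ ⟩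
      x * y * (ι b * ι (b ℕ.^ ℓ))                    ≡⟨ cong (x * y *_) (ι-* b _) ⟨
      x * y * ι (b ℕ.* b ℕ.^ ℓ)                      ∎
      where
      open ℚ.≤-Reasoning
      x = seq p i
      y = seq (p ^ᵣ ℓ) i
      regroup : ∀ x u y v → x * u * (y * v) ≡ x * y * (u * v)
      regroup = solve 4 (λ x u y v → x :* u :* (y :* v) := x :* y :* (u :* v)) refl
        where open +-*-Solver

    module _ {n : ℕ} (J : Graph n) (a≤b : a ℕ.≤ b) where

      -- Each of the `C ℓ J` edge sets has at least ℓ edges, hence weight at most a^ℓ b^(e - ℓ) for
      -- e = `pairs n` and ℓ ≤ e, and a/b is at most the current term of `p`. The factor b^ℓ is
      -- multiplied in to avoid the subtraction.
      cycle-weight : ∀ ℓ → ι (sum (map (weight a b) (cyclesOfLength J ℓ)))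
                           ≤ ι (b ℕ.^ pairs n) * seq (p ^ᵣ ℓ *ᵣ fromℕ (C ℓ J)) i
      cycle-weight ℓ = ℚ.*-cancelʳ-≤-pos (ι (b ℕ.^ ℓ)) {{ι-pos (b ℕ.^ ℓ) {{ℕ.m^n≢0 b ℓ}}}} (begin
        ι W * ι (b ℕ.^ ℓ)                              ≡⟨ ι-* W _ ⟨
        ι (W ℕ.* b ℕ.^ ℓ)                              ≤⟨ ι-mono-≤ bound ⟩
        ι (C ℓ J ℕ.* (a ℕ.^ ℓ ℕ.* b ℕ.^ pairs n))
          ≡⟨ trans (ι-* (C ℓ J) _) (cong (ι (C ℓ J) *_) (ι-* (a ℕ.^ ℓ) _)) ⟩
        c * (ι (a ℕ.^ ℓ) * D)
          ≤⟨ *-mono-≤ (0≤ι (C ℓ J)) (0≤* (0≤ι (a ℕ.^ ℓ)) (0≤ι (b ℕ.^ pairs n))) ℚ.≤-refl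
               (*-mono-≤ (0≤* (0≤^ᵣ ℓ) (0≤ι (b ℕ.^ ℓ))) (0≤ι (b ℕ.^ pairs n)) (ι-^-≤ ℓ) ℚ.≤-refl) ⟩
        c * (x * ι (b ℕ.^ ℓ) * D)                      ≡⟨ regroup c x (ι (b ℕ.^ ℓ)) D ⟩
        D * (x * c) * ι (b ℕ.^ ℓ)                      ∎)
        where
        open ℚ.≤-Reasoning
        W = sum (map (weight a b) (cyclesOfLength J ℓ))
        D = ι (b ℕ.^ pairs n)
        c = ι (C ℓ J)
        x = seq (p ^ᵣ ℓ) i
        bound : W ℕ.* b ℕ.^ ℓ ℕ.≤ C ℓ J ℕ.* (a ℕ.^ ℓ ℕ.* b ℕ.^ pairs n)
        bound = subst (λ k → W ℕ.* b ℕ.^ ℓ ℕ.≤ k ℕ.* (a ℕ.^ ℓ ℕ.* b ℕ.^ pairs n))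
          (length-map (edges ∘ entry) (cycleSubgraphs ℓ J))
          (sum-map-≤ (weight a b) (b ℕ.^ ℓ) _ (cyclesOfLength J ℓ)
            λ {t} t∈ → weight-≤ t a≤b (proj₂ (∈-cyclesOfLength⁻ J t∈)))
        regroup : ∀ c x u D → c * (x * u * D) ≡ D * (x * c) * u
        regroup = solve 4 (λ c x u D → c :* (x :* u :* D) := D :* (x :* c) :* u) refl
          where open +-*-Solver

      shortCycles-weight : ∀ r → ι (sum (map (weight a b) (shortCycles J r)))
                                 ≤ ι (b ℕ.^ pairs n) * seq (weightedShortCycles p r J) i
      shortCycles-weight r = subst (λ W → ι W ≤ ι (b ℕ.^ pairs n) * seq (weightedShortCycles p r J) i)
        (sym (sum-map-concat (weight a b) (cyclesOfLength J ∘ (3 ℕ.+_)) (r ℕ.∸ 3)))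
        (ι-sumᵣ-≤ i (ι (b ℕ.^ pairs n)) (λ j → p ^ᵣ (3 ℕ.+ j) *ᵣ fromℕ (C (3 ℕ.+ j) J)) _ (r ℕ.∸ 3)
          λ j → cycle-weight (3 ℕ.+ j))

  -- From real hypotheses to integer inequalities

  module _ {n : ℕ} (J : Graph n) (r q m d : ℕ) .{{_ : NonZero q}} .{{d≢0 : NonZero d}}
           (q+d≡m : q ℕ.+ d ≡ m) (p : ℝ) where

    private
      μ = M m q

      μ-* : μ * ι (2 ℕ.* q) ≡ ι (d ℕ.* d)
      μ-* = trans (cong (λ m → M m q * ι (2 ℕ.* q)) (sym q+d≡m)) (M-* q d)

      instance
        2q≢0 : NonZero (2 ℕ.* q)
        2q≢0 = ℕ.m*n≢0 2 q

        μ-pos : Positive μ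
        μ-pos = ℚ.positive (ℚ.*-cancelʳ-<-nonNeg (ι (2 ℕ.* q)) {{ι-nonNeg (2 ℕ.* q)}} {0ℚ} {μ}
          (subst₂ _<_ (sym (ℚ.*-zeroˡ (ι (2 ℕ.* q)))) (sym μ-*)
            (ℚ.positive⁻¹ (ι (d ℕ.* d)) {{ι-pos (d ℕ.* d) {{ℕ.m*n≢0 d d}}}})))

        μ≢0 : ℚ.NonZero μ
        μ≢0 = ℚ.pos⇒nonZero μ

    module _ (i a a′ : ℕ) .{{_ : NonZero (a ℕ.+ a′)}} (y : ℚ) (yb≡a : y * ι (a ℕ.+ a′) ≡ ι a)
             (0<x : 0ℚ < seq p i) (y≤x : y ≤ seq p i) (xμ≤yμ+1 : seq p i * μ ≤ y * μ + 1ℚ) where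

      private
        x = seq p i
        b = a ℕ.+ a′
        A = a ℕ.* sq d
        B = b ℕ.* (2 ℕ.* q)

      open ℚ.≤-Reasoning

      -- Clearing denominators, with yμ = A / B.
      clear : ∀ {z} → z ≤ x * μ + 1ℚ → z * ι B ≤ ι (A ℕ.+ 2 ℕ.* B)
      clear {z} z≤ = begin
        z * ι B
          ≤⟨ ℚ.*-monoʳ-≤-nonNeg (ι B) {{ι-nonNeg B}} (ℚ.≤-trans z≤ (ℚ.+-monoˡ-≤ 1ℚ xμ≤yμ+1)) ⟩
        (y * μ + 1ℚ + 1ℚ) * ι B               ≡⟨ cong (_* ι B) (ℚ.+-assoc (y * μ) 1ℚ 1ℚ) ⟩
        (y * μ + ι 2) * ι B                   ≡⟨ ℚ.*-distribʳ-+ (ι B) (y * μ) (ι 2) ⟩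
        y * μ * ι B + ι 2 * ι B
          ≡⟨ cong₂ _+_ (cong (y * μ *_) (ι-* b (2 ℕ.* q))) (sym (ι-* 2 B)) ⟩
        y * μ * (ι b * ι (2 ℕ.* q)) + ι (2 ℕ.* B)
          ≡⟨ cong (_+ ι (2 ℕ.* B)) (regroup y μ (ι b) (ι (2 ℕ.* q))) ⟩
        y * ι b * (μ * ι (2 ℕ.* q)) + ι (2 ℕ.* B)
          ≡⟨ cong (_+ ι (2 ℕ.* B)) (trans (cong₂ _*_ yb≡a μ-*) (sym (ι-* a (sq d)))) ⟩
        ι A + ι (2 ℕ.* B)                     ≡⟨ ι-+ A (2 ℕ.* B) ⟨
        ι (A ℕ.+ 2 ℕ.* B)                     ∎
        where
        regroup : ∀ y μ u v → y * μ * (u * v) ≡ y * u * (μ * v)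
        regroup = solve 4 (λ y μ u v → y :* μ :* (u :* v) := y :* u :* (μ :* v)) refl
          where open +-*-Solver

      -- The bounds log q ≥ L/4 and log 4 ≥ 1, in Riemann-sum form, turn 16(n log q + log 4) into
      -- 4nL + 16.
      dense-≤ : ∀ L → (∀ N .{{_ : NonZero N}} → ι L ≤ ι 4 * riemannSum q N) →
        ι 16 * (ι n * riemannSum q (suc i) + riemannSum 4 (suc i)) ≤ x * μ + 1ℚ →
        (4 ℕ.* (n ℕ.* L) ℕ.+ 16) ℕ.* B ℕ.≤ A ℕ.+ 2 ℕ.* B
      dense-≤ L R≥ dense = ι-cancel-≤ (subst (_≤ ι (A ℕ.+ 2 ℕ.* B))
        (sym (ι-* (4 ℕ.* (n ℕ.* L) ℕ.+ 16) B)) (clear (begin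
        ι (4 ℕ.* (n ℕ.* L) ℕ.+ 16)                      ≡⟨ cong ι (regroup n L) ⟩
        ι (4 ℕ.* (n ℕ.* L ℕ.+ 4))
          ≡⟨ trans (ι-* 4 (n ℕ.* L ℕ.+ 4))
               (cong (ι 4 *_) (trans (ι-+ (n ℕ.* L) 4) (cong (_+ ι 4) (ι-* n L)))) ⟩
        ι 4 * (ι n * ι L + ι 4)
          ≤⟨ ℚ.*-monoˡ-≤-nonNeg (ι 4) {{ι-nonNeg 4}} (ℚ.+-mono-≤
               (ℚ.*-monoˡ-≤-nonNeg (ι n) {{ι-nonNeg n}} (R≥ (suc i)))
               (*-mono-≤ (0≤ι 4) (0≤ι 1) (ℚ.≤-refl {ι 4}) one≤log4)) ⟩
        ι 4 * (ι n * (ι 4 * R) + ι 4 * R₄)              ≡⟨ collect (ι 4) (ι n) R R₄ ⟩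
        ι 4 * ι 4 * (ι n * R + R₄)                      ≤⟨ dense ⟩
        x * μ + 1ℚ                                      ∎)))
        where
        R = riemannSum q (suc i)
        R₄ = riemannSum 4 (suc i)
        one≤log4 : 1ℚ ≤ R₄
        one≤log4 = ℚ.*-cancelˡ-≤-pos (ι 2) (riemannSum-2^ 2 (suc i))
        regroup : ∀ n L → 4 ℕ.* (n ℕ.* L) ℕ.+ 16 ≡ 4 ℕ.* (n ℕ.* L ℕ.+ 4)
        regroup = ℕ.solve-∀
        collect : ∀ k n R R₄ → k * (n * (k * R) + k * R₄) ≡ k * k * (n * R + R₄)
        collect = solve 4 (λ k n R R₄ → k :* (n :* (k :* R) :+ k :* R₄) := k :* k :* (n :* R :+ R₄)) refl
          where open +-*-Solver

      sparse-≤ : seq (weightedShortCycles p r J) i ≤ x * μ * (+ 1 / 16) + + 1 / 16 →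
        16 ℕ.* sum (map (weight a b) (shortCycles J r)) ℕ.* B ℕ.≤ (A ℕ.+ 2 ℕ.* B) ℕ.* b ℕ.^ pairs n
      sparse-≤ sparse = ι-cancel-≤ (begin
        ι (16 ℕ.* W ℕ.* B)                ≡⟨ trans (ι-* (16 ℕ.* W) B) (cong (_* ι B) (ι-* 16 W)) ⟩
        ι 16 * ι W * ι B
          ≤⟨ ℚ.*-monoʳ-≤-nonNeg (ι B) {{ι-nonNeg B}} (ℚ.*-monoˡ-≤-nonNeg (ι 16) {{ι-nonNeg 16}}
               (shortCycles-weight p i a b (ℚ.<⇒≤ 0<x) a≤xb J (ℕ.m≤m+n a a′) r)) ⟩
        ι 16 * (D * w) * ι B              ≡⟨ regroup (ι 16) D w (ι B) ⟩
        D * (ι 16 * w * ι B)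
          ≤⟨ ℚ.*-monoˡ-≤-nonNeg D {{ι-nonNeg (b ℕ.^ pairs n)}} (clear 16w≤) ⟩
        D * ι (A ℕ.+ 2 ℕ.* B)             ≡⟨ trans (ℚ.*-comm D _) (sym (ι-* (A ℕ.+ 2 ℕ.* B) _)) ⟩
        ι ((A ℕ.+ 2 ℕ.* B) ℕ.* b ℕ.^ pairs n) ∎)
        where
        W = sum (map (weight a b) (shortCycles J r))
        D = ι (b ℕ.^ pairs n)
        w = seq (weightedShortCycles p r J) i
        a≤xb : ι a ≤ x * ι b
        a≤xb = subst (_≤ x * ι b) yb≡a (ℚ.*-monoʳ-≤-nonNeg (ι b) {{ι-nonNeg b}} y≤x)
        regroup : ∀ k D w u → k * (D * w) * u ≡ D * (k * w * u)
        regroup = solve 4 (λ k D w u → k :* (D :* w) :* u := D :* (k :* w :* u)) refl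
          where open +-*-Solver
        factor : ∀ k z u → k * (z * u + u) ≡ (z + 1ℚ) * (k * u)
        factor = solve 3 (λ k z u → k :* (z :* u :+ u) := (z :+ con 1ℚ) :* (k :* u)) refl
          where open +-*-Solver
        16w≤ : ι 16 * w ≤ x * μ + 1ℚ
        16w≤ = begin
          ι 16 * w
            ≤⟨ ℚ.*-monoˡ-≤-nonNeg (ι 16) {{ι-nonNeg 16}} sparse ⟩
          ι 16 * (x * μ * (+ 1 / 16) + + 1 / 16)     ≡⟨ factor (ι 16) (x * μ) (+ 1 / 16) ⟩
          (x * μ + 1ℚ) * (ι 16 * (+ 1 / 16))         ≡⟨ ℚ.*-identityʳ (x * μ + 1ℚ) ⟩
          x * μ + 1ℚ                                 ∎

    Discretised : Set
    Discretised = ∃[ a ] ∃[ a′ ] ∃[ L ] NonZero (a ℕ.+ a′) × q ℕ.≤ 2 ℕ.^ L ×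
      let b = a ℕ.+ a′
          A = a ℕ.* sq d
          B = b ℕ.* (2 ℕ.* q)
      in (4 ℕ.* (n ℕ.* L) ℕ.+ 16) ℕ.* B ℕ.≤ A ℕ.+ 2 ℕ.* B ×
         16 ℕ.* sum (map (weight a b) (shortCycles J r)) ℕ.* B ℕ.≤ (A ℕ.+ 2 ℕ.* B) ℕ.* b ℕ.^ pairs n

    -- One index past all four thresholds replaces every real by a rational term. Each inequality
    -- then loses one unit of pM to its tolerance and one to truncation, which makes up the allowed
    -- 2.
    discretise : fromℚ 0ℚ <ᵣ p → p ≤ᵣ fromℚ 1ℚ →
      fromℕ 16 *ᵣ (fromℕ n *ᵣ log q +ᵣ log 4) ≤ᵣ p *ᵣ fromℚ μ →
      weightedShortCycles p r J ≤ᵣ p *ᵣ fromℚ μ *ᵣ fromℚ (+ 1 / 16) →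
      Discretised
    discretise (δ , 0<δ , N₁ , positive) p≤1 dense sparse =
      -- Tolerance 1/μ makes truncation cost exactly one unit of pM at most; tolerance 1/16 for the
      -- cycle sum becomes 1 after multiplication by 16.
      let N₂ , bounded  = p≤1 (1/ μ) (ℚ.positive⁻¹ (1/ μ) {{ℚ.1/pos⇒pos μ}})
          N₃ , dense′   = dense 1ℚ (ℚ.positive⁻¹ 1ℚ)
          N₄ , sparse′  = sparse (+ 1 / 16) (ℚ.positive⁻¹ (+ 1 / 16))
          i     = (N₁ ℕ.⊔ N₂) ℕ.⊔ (N₃ ℕ.⊔ N₄)
          x     = seq p i
          N₁₂≤i = ℕ.m≤m⊔n (N₁ ℕ.⊔ N₂) (N₃ ℕ.⊔ N₄)
          N₃₄≤i = ℕ.m≤n⊔m (N₁ ℕ.⊔ N₂) (N₃ ℕ.⊔ N₄)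
          δ≤x   = subst (_≤ x) (ℚ.+-identityˡ δ) (positive i (ℕ.m⊔n≤o⇒m≤o N₁ N₂ N₁₂≤i))
          0<x   = ℚ.<-≤-trans 0<δ δ≤x
          y , 0<y , y≤1 , y≤x , xμ≤yμ+1 =
            truncate x (1/ μ) μ (ℚ.<⇒≤ (ℚ.positive⁻¹ μ)) (ℚ.*-inverseˡ μ) 0<x
              (bounded i (ℕ.m⊔n≤o⇒n≤o N₁ N₂ N₁₂≤i))
          a , a′ , b≢0 , yb≡a = fraction y 0<y y≤1
          L , q≤2^L , R≥ = riemannSum-≥ q
      in a , a′ , L , b≢0 , q≤2^L ,
         dense-≤ i a a′ {{b≢0}} y yb≡a 0<x y≤x xμ≤yμ+1 L R≥ (dense′ i (ℕ.m⊔n≤o⇒m≤o N₃ N₄ N₃₄≤i)) ,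
         sparse-≤ i a a′ {{b≢0}} y yb≡a 0<x y≤x xμ≤yμ+1 (sparse′ i (ℕ.m⊔n≤o⇒n≤o N₃ N₄ N₃₄≤i))

-- Combining the discretisation with the probabilistic estimate

open import Data.Nat using (ℕ; suc; NonZero; _≤_; _<_; _∸_; >-nonZero)
import Data.Nat.Properties as ℕ
open import Data.Integer using (+_)
open import Data.Rational using (0ℚ; 1ℚ; _/_)
open import Relation.Nullary.Construct.Add.Supremum using () renaming ([_] to fin)
open import Relation.Binary.Construct.Add.Supremum.NonStrict _≤_ using (_≤⁺_)

theorem3p1 : (r q : ℕ) .{{_ : NonZero q}} → 4 ≤ r →
    (n m : ℕ) (J : Graph n) → IsChromaticNumber J m → q < m →
    (p : ℝ) → fromℚ 0ℚ <ᵣ p → p ≤ᵣ fromℚ 1ℚ →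
    fromℕ 16 *ᵣ (fromℕ n *ᵣ log q +ᵣ log 4) ≤ᵣ p *ᵣ fromℚ (M m q) →
    weightedShortCycles p r J ≤ᵣ p *ᵣ fromℚ (M m q) *ᵣ fromℚ (+ 1 / 16) →
    ∃[ k ] Σ[ H ∈ Graph k ] H ⊆ᴳ J ×
    (∃[ g ] IsGirth H g × fin r ≤⁺ g) ×
    (∃[ χ ] IsChromaticNumber H χ × suc q ≤ χ)
theorem3p1 r q _ n m J (_ , minimal) q<m p 0<p p≤1 dense sparse =
  -- Since q < m, d is positive, so M = d²/2q is positive and its inverse can serve as a tolerance.
  let d = m ∸ q
      q+d≡m = ℕ.m+[n∸m]≡n (ℕ.<⇒≤ q<m)
      a , a′ , L , b≢0 , q≤2^L , dense′ , sparse′ =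
        discretise J r q m d {{d≢0 = >-nonZero (ℕ.m<n⇒0<n∸m q<m)}}
          q+d≡m p 0<p p≤1 dense sparse
  in dense-sparse J r q d a a′ L {{b≢0 = b≢0}} (λ k c → subst (_≤ k) (sym q+d≡m) (minimal k c))
       q≤2^L dense′ sparse′
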